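{- For every integer $k \geq 3$ and every real $\varepsilon > 0$, there exists an instance $\mathcal{I}_{k,\varepsilon}$ of Multiway Cut with $k$ terminals such that the integrality gap of the Călinescu–Karloff–Rabani (CKR) LP relaxation on $\mathcal{I}_{k,\varepsilon}$ is at least $\frac{6}{5 + \frac{1}{k-1}} - \varepsilon$.
   Context: Multiway Cut: given an undirected graph $G=(V,E)$ with nonnegative edge weights $w$ and terminals $t_1,\dots,t_k \in V$, find a partition of $V$ into $k$ parts, the $i$-th containing $t_i$, minimizing the total weight of edges whose endpoints lie in different parts. The CKR relaxation is: minimize $\sum_{e=(u,v)\in E} w(e)\cdot \frac12\|x^u - x^v\|_1$ subject to $x^u \in \Delta_k := \{x\in[0,1]^k : x_1+\dots+x_k = 1\}$ for all $u\in V$ and $x^{t_i} = e^i$ (the $i$-th standard basis vector) for all $i\in[k]=\{1,\dots,k\}$. The integrality gap of an instance is the ratio of its integral optimum to the optimum value of the CKR relaxation. -}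

module Defs where

open import Data.Nat using (ℕ; zero; suc; _∸_) renaming (_*_ to _*ℕ_)
open import Data.Fin using (Fin; zero; suc; _≟_)
open import Data.Integer using (+_)
open import Data.Rational using (ℚ; 0ℚ; 1ℚ; _+_; _*_; _-_; ∣_∣; _≤_; _/_; ½)
open import Data.List using (List; foldr)
open import Data.List.Relation.Unary.All using (All)
open import Data.Product using (Σ; _×_)
open import Relation.Nullary using (yes; no)
open import Relation.Binary.PropositionalEquality using (_≡_)
open import Function.Definitions using (Injective)

Σℚ : (m : ℕ) → (Fin m → ℚ) → ℚ
Σℚ zero    f = 0ℚ
Σℚ (suc m) f = f zero + Σℚ m (λ i → f (suc i))

record Edge (n : ℕ) : Set where
  constructor edge
  field
    u v : Fin n
    w   : ℚ

open Edge public

record Instance (k : ℕ) : Set where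
  field
    n         : ℕ
    edges     : List (Edge n)
    weights≥0 : All (λ e → 0ℚ ≤ w e) edges
    terminal  : Fin k → Fin n
    terminals-distinct : Injective _≡_ _≡_ terminal

open Instance public

basis : {k : ℕ} → Fin k → Fin k → ℚ
basis i j with i ≟ j
... | yes _ = 1ℚ
... | no  _ = 0ℚ

CKRFeasible : {k : ℕ} (I : Instance k) → (Fin (n I) → Fin k → ℚ) → Set
CKRFeasible {k} I x =
  ((u : Fin (n I)) (i : Fin k) → 0ℚ ≤ x u i) ×
  ((u : Fin (n I)) → Σℚ k (x u) ≡ 1ℚ) ×
  ((i j : Fin k) → x (terminal I i) j ≡ basis i j)

CKRCost : {k : ℕ} (I : Instance k) → (Fin (n I) → Fin k → ℚ) → ℚ
CKRCost {k} I x =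
  foldr (λ e acc → w e * (½ * Σℚ k (λ i → ∣ x (u e) i - x (v e) i ∣)) + acc)
        0ℚ (edges I)

-- Optimum value of the CKR relaxation (attained, as for any feasible LP
-- with rational data that is bounded below).
IsCKROpt : {k : ℕ} (I : Instance k) → ℚ → Set
IsCKROpt I val =
  Σ (Fin (n I) → Fin _ → ℚ) (λ x → CKRFeasible I x × CKRCost I x ≡ val) ×
  ((x : Fin (n I) → Fin _ → ℚ) → CKRFeasible I x → val ≤ CKRCost I x)

-- A multiway cut: partition of V into k parts, the i-th containing t_i,
-- given by the part-index map σ : V → [k].
IsMultiwayCut : {k : ℕ} (I : Instance k) → (Fin (n I) → Fin k) → Set
IsMultiwayCut I σ = ∀ i → σ (terminal I i) ≡ i

CutCost : {k : ℕ} (I : Instance k) → (Fin (n I) → Fin k) → ℚ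
CutCost I σ = foldr step 0ℚ (edges I)
  where
  step : Edge (n I) → ℚ → ℚ
  step e acc with σ (u e) ≟ σ (v e)
  ... | yes _ = acc
  ... | no  _ = w e + acc

IsIntOpt : {k : ℕ} (I : Instance k) → ℚ → Set
IsIntOpt {k} I val =
  Σ (Fin (n I) → Fin k) (λ σ → IsMultiwayCut I σ × CutCost I σ ≡ val) ×
  ((σ : Fin (n I) → Fin k) → IsMultiwayCut I σ → val ≤ CutCost I σ)

-- 6 / (5 + 1/(k−1)) = 6(k−1) / (5(k−1)+1), written with a nonzero denominator.
gapBound : ℕ → ℚ
gapBound k = + (6 *ℕ (k ∸ 1)) / suc (5 *ℕ (k ∸ 1))

-- Integrality gap ≥ c: the LP optimum is positive (so the ratio is defined)
-- and integral optimum / LP optimum ≥ c.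
IntegralityGapAtLeast : {k : ℕ} (I : Instance k) → ℚ → Set
IntegralityGapAtLeast I c =
  Σ ℚ (λ lp → Σ ℚ (λ int →
    IsCKROpt I lp × IsIntOpt I int × (0ℚ Data.Rational.< lp) × (c * lp ≤ int)))

{-# OPTIONS --safe #-}
module Submission where

-- For every ordered triple (i, j, l) of distinct terminals take, in a triangular grid on the face
-- spanned by eⁱ, eʲ, eˡ, the points with all coordinates at most 2/3: a hexagon with side length q.
-- Each of its three sides on which a coordinate is 2/3 is joined to the nearby terminal by a star; the other
-- three sides lie on edges of the simplex, are shared by all triples, and also carry a path of weight 12 q between the two terminals.
-- A hexagon has fractional cost at most 10 q + 2 and a path has fractional cost 12 q.
--
-- A cut of a hexagon is bounded by a calibration.  Every label has a potential on the grid, and around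
-- any small triangle the potential jumps between the labels of consecutive vertices add up to at most
-- the number of cut edges of the triangle.  By the discrete Stokes formula the cost of the hexagon is at
-- least a boundary term, which is at least 12 q - 4 q · #(sides meeting the part of the opposite terminal).
-- Each foreign label on a side costs one more cut of the path along it, and this pays 12 q for the loss of
-- 4 q in each of the three rotations of the triple.  So every multiway cut costs at least 12 q k (k - 1)²,
-- whereas the relaxation costs at most k (k - 1) ((k - 2) (10 q + 2) + 12 q).

-- Hexagons alone would have the ratio 12/10, but a cut can make a hexagon cheap by letting the part
-- of the opposite terminal reach one of its sides. The paths make this expensive, at the price of
-- having ratio 1 themselves. There is one path per ordered pair of terminals and there are k - 2
-- hexagons per ordered pair, so the mixture compares 12 (k - 1) with 10 (k - 2) + 12, which is the
-- stated bound.
--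
-- The threefold symmetry reduces the calibration to one rhombus: a cyclic relabelling carries it to
-- the next rhombus, so the terms on the common axes cancel. All terminals outside the triple are
-- merged into one label, which can only remove cut edges; hence every local inequality is a finite
-- check on four labels.
--
-- The integrality gap is stated through optimal values in ℚ. The integral one is a minimum over
-- finitely many labellings. For the relaxation, all variables are eliminated from the system
-- "feasible and of cost at most z"; the inequalities in z alone that remain have a least rational
-- solution.

open import Defs
open import Data.Empty using (⊥-elim)
open import Data.Fin using (Fin; zero; suc; toℕ; combine; remQuot; _≟_)
open import Data.Fin.Patterns using (0F; 1F; 2F; 3F)
open import Data.Fin.Properties using (all?; any?; toℕ<n; toℕ-fromℕ<; toℕ≤pred[n]; remQuot-combine; +↔⊎; *↔×)
open import Data.Integer using (-[1+_])
import Data.Integer as ℤ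
import Data.Integer.Tactic.RingSolver as ℤ-solver
open import Data.List using (List; []; _∷_; _++_; map; foldr; allFin)
open import Data.List.Membership.Propositional.Properties using (∈-allFin)
open import Data.List.Relation.Unary.All using (All; []; _∷_)
import Data.List.Relation.Unary.All as All
import Data.List.Relation.Unary.All.Properties as All
open import Data.Nat using (ℕ; zero; suc; _≥_)
import Data.Nat as ℕ
import Data.Nat.Properties as ℕₚ
open import Data.Nat.DivMod using (_mod_; m<n⇒m%n≡m)
open import Data.Product using (Σ; ∃; _×_; _,_; proj₁; proj₂; uncurry)
open import Data.Product.Function.NonDependent.Propositional using (_×-↔_)
open import Data.Rational hiding (_≟_; _≥_)
open import Data.Rational.Properties hiding (_≟_)
import Data.Rational.Properties as ℚₚ
open import Data.Rational.Unnormalised using (mkℚᵘ; *≡*) renaming (_≃_ to _≃ᵘ_)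
import Data.Rational.Unnormalised.Properties as ℚᵘₚ
open import Relation.Binary.Bundles using (DecTotalOrder)
open import Data.List.Extrema (DecTotalOrder.totalOrder ℚₚ.≤-decTotalOrder) using (argmin; f[argmin]≤f[xs])
open import Data.Sum using (_⊎_; inj₁; inj₂)
open import Data.Sum.Function.Propositional using (_⊎-↔_)
open import Data.Sum.Properties using (inj₁-injective)
open import Data.Vec.Functional using () renaming (_∷_ to _◂_)
open import Function using (_∘_; _⇔_; mk⇔; _↔_; Inverse; Equivalence)
open import Function.Properties.Inverse using (↔-refl; ↔-sym; ↔-trans)
open import Relation.Binary.Definitions using (tri<; tri≈; tri>)
open import Relation.Binary.PropositionalEquality hiding (J)
open import Relation.Nullary using (Dec; yes; no; ¬_)
open import Relation.Nullary.Decidable using (¬?; _×-dec_; dec⇒maybe; decidable-stable; from-yes)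
open import Tactic.RingSolver using (solve-∀)
open import Tactic.RingSolver.Core.AlmostCommutativeRing using (AlmostCommutativeRing; fromCommutativeRing)
open Equivalence using (to; from)

-- Sums of rationals

ℚ-ring : AlmostCommutativeRing _ _
ℚ-ring = fromCommutativeRing +-*-commutativeRing (λ x → dec⇒maybe (0ℚ ℚₚ.≟ x))

ι : ℕ → ℚ
ι zero    = 0ℚ
ι (suc m) = 1ℚ + ι m

2ℚ 4ℚ : ℚ
2ℚ = 1ℚ + 1ℚ
4ℚ = 2ℚ + 2ℚ

0≤1 : 0ℚ ≤ 1ℚ
0≤1 = nonNegative⁻¹ 1ℚ

ι≥0 : ∀ m → 0ℚ ≤ ι m
ι≥0 zero    = ≤-refl
ι≥0 (suc m) = +-mono-≤ 0≤1 (ι≥0 m)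

*-nonneg : ∀ {p q} → 0ℚ ≤ p → 0ℚ ≤ q → 0ℚ ≤ p * q
*-nonneg {p} {q} 0≤p 0≤q = subst (_≤ p * q) (*-zeroʳ p) (*-monoˡ-≤-nonNeg p {{nonNegative 0≤p}} 0≤q)

*-monoˡ : ∀ {p q r} → 0ℚ ≤ r → p ≤ q → r * p ≤ r * q
*-monoˡ {r = r} 0≤r = *-monoˡ-≤-nonNeg r {{nonNegative 0≤r}}

p≤q⇒0≤q-p : ∀ {p q} → p ≤ q → 0ℚ ≤ q - p
p≤q⇒0≤q-p {p} {q} p≤q = subst (_≤ q - p) (+-inverseʳ p) (+-monoˡ-≤ (- p) p≤q)

0≤q-p⇒p≤q : ∀ {p q} → 0ℚ ≤ q - p → p ≤ q
0≤q-p⇒p≤q {p} {q} h = subst₂ _≤_ (+-identityʳ p) (lem p q) (+-monoʳ-≤ p h)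
  where
  lem : ∀ p q → p + (q - p) ≡ q
  lem = solve-∀ ℚ-ring

p≤∣p∣ : ∀ p → p ≤ ∣ p ∣
p≤∣p∣ p with ≤-total 0ℚ p
... | inj₁ 0≤p = ≤-reflexive (sym (0≤p⇒∣p∣≡p 0≤p))
... | inj₂ p≤0 = ≤-trans p≤0 (0≤∣p∣ p)

Σ-cong : ∀ m {f g : Fin m → ℚ} → (∀ i → f i ≡ g i) → Σℚ m f ≡ Σℚ m g
Σ-cong zero    h = refl
Σ-cong (suc m) h = cong₂ _+_ (h zero) (Σ-cong m (h ∘ suc))

Σ-mono : ∀ m {f g : Fin m → ℚ} → (∀ i → f i ≤ g i) → Σℚ m f ≤ Σℚ m g
Σ-mono zero    h = ≤-refl
Σ-mono (suc m) h = +-mono-≤ (h zero) (Σ-mono m (h ∘ suc))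

+-interchange : ∀ a b c d → (a + b) + (c + d) ≡ (a + c) + (b + d)
+-interchange = solve-∀ ℚ-ring

Σ-+ : ∀ m (f g : Fin m → ℚ) → Σℚ m (λ i → f i + g i) ≡ Σℚ m f + Σℚ m g
Σ-+ zero    f g = refl
Σ-+ (suc m) f g = trans (cong (f zero + g zero +_) (Σ-+ m (f ∘ suc) (g ∘ suc))) (+-interchange (f zero) (g zero) _ _)

Σ-* : ∀ m c (f : Fin m → ℚ) → Σℚ m (λ i → c * f i) ≡ c * Σℚ m f
Σ-* zero    c f = sym (*-zeroʳ c)
Σ-* (suc m) c f = trans (cong (c * f zero +_) (Σ-* m c (f ∘ suc))) (sym (*-distribˡ-+ c (f zero) _))

Σ-const : ∀ m c → Σℚ m (λ _ → c) ≡ ι m * c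
Σ-const zero    c = sym (*-zeroˡ c)
Σ-const (suc m) c = trans (cong (c +_) (Σ-const m c)) (lem c (ι m))
  where
  lem : ∀ c x → c + x * c ≡ (1ℚ + x) * c
  lem = solve-∀ ℚ-ring

Σ-0 : ∀ m → Σℚ m (λ _ → 0ℚ) ≡ 0ℚ
Σ-0 m = trans (Σ-const m 0ℚ) (*-zeroʳ (ι m))

Σ-neg : ∀ m (f : Fin m → ℚ) → Σℚ m (λ i → - f i) ≡ - Σℚ m f
Σ-neg zero    f = refl
Σ-neg (suc m) f = trans (cong (- f zero +_) (Σ-neg m (f ∘ suc))) (sym (neg-distrib-+ (f zero) _))

Σ-- : ∀ m (f g : Fin m → ℚ) → Σℚ m (λ i → f i - g i) ≡ Σℚ m f - Σℚ m g
Σ-- m f g = trans (Σ-+ m f (-_ ∘ g)) (cong (Σℚ m f +_) (Σ-neg m g))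

Σ≥0 : ∀ m {f : Fin m → ℚ} → (∀ i → 0ℚ ≤ f i) → 0ℚ ≤ Σℚ m f
Σ≥0 m {f} h = subst (_≤ Σℚ m f) (Σ-0 m) (Σ-mono m h)

Σ-swap : ∀ m n (f : Fin m → Fin n → ℚ) → Σℚ m (λ i → Σℚ n (f i)) ≡ Σℚ n (λ j → Σℚ m (λ i → f i j))
Σ-swap zero    n f = sym (Σ-0 n)
Σ-swap (suc m) n f = trans (cong (Σℚ n (f zero) +_) (Σ-swap m n (f ∘ suc)))
  (sym (Σ-+ n (f zero) (λ j → Σℚ m (λ i → f (suc i) j))))

∑ : ℕ → (ℕ → ℚ) → ℚ
∑ m f = Σℚ m (f ∘ toℕ)

∑-telescope : ∀ m (f : ℕ → ℚ) → ∑ m (λ a → f (suc a) - f a) ≡ f m - f 0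
∑-telescope zero    f = sym (+-inverseʳ (f 0))
∑-telescope (suc m) f = trans (cong (f 1 - f 0 +_) (∑-telescope m (f ∘ suc))) (lem (f 0) (f 1) (f (suc m)))
  where
  lem : ∀ x y z → (y - x) + (z - y) ≡ z - x
  lem = solve-∀ ℚ-ring

basis-refl : ∀ {k} (i : Fin k) → basis i i ≡ 1ℚ
basis-refl i with i ≟ i
... | yes _ = refl
... | no i≢i with () ← i≢i refl

basis-≢ : ∀ {k} {i j : Fin k} → i ≢ j → basis i j ≡ 0ℚ
basis-≢ {i = i} {j} i≢j with i ≟ j
... | yes i≡j with () ← i≢j i≡j
... | no _ = refl

basis-≥0 : ∀ {k} (i j : Fin k) → 0ℚ ≤ basis i j
basis-≥0 i j with i ≟ j
... | yes _ = 0≤1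
... | no _ = ≤-refl

basis-suc : ∀ {k} (i j : Fin k) → basis (suc i) (suc j) ≡ basis i j
basis-suc i j with i ≟ j
... | yes _ = refl
... | no _ = refl

Σ-basis : ∀ {k} (i : Fin k) → Σℚ k (basis i) ≡ 1ℚ
Σ-basis {suc k} zero    = trans (cong (1ℚ +_) (Σ-0 k)) refl
Σ-basis {suc k} (suc i) = trans (cong (0ℚ +_) (trans (Σ-cong k (basis-suc i)) (Σ-basis i))) refl

Σ-basis-* : ∀ {k} (i : Fin k) (f : Fin k → ℚ) → Σℚ k (λ j → basis i j * f j) ≡ f i
Σ-basis-* {suc k} zero f = trans
  (cong₂ _+_ (*-identityˡ (f zero)) (trans (Σ-cong k (λ j → *-zeroˡ (f (suc j)))) (Σ-0 k)))
  (+-identityʳ (f zero))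
Σ-basis-* {suc k} (suc i) f = trans
  (cong₂ _+_ (*-zeroˡ (f zero)) (trans (Σ-cong k (λ j → cong (_* f (suc j)) (basis-suc i j))) (Σ-basis-* i (f ∘ suc))))
  (+-identityˡ (f (suc i)))

-- Attainment of the CKR optimum

-- The parameter is the bound on the objective: elimination of all variables keeps it.
record Form (N : ℕ) : Set where
  constructor form
  field
    coef     : Fin N → ℚ
    param    : ℚ
    constant : ℚ
open Form

⟦_⟧ : ∀ {N} → Form N → (Fin N → ℚ) → ℚ → ℚ
⟦_⟧ {N} l y z = Σℚ N (λ i → coef l i * y i) + (param l * z + constant l)

Holds : ∀ {N} → List (Form N) → (Fin N → ℚ) → ℚ → Set
Holds L y z = All (λ l → 0ℚ ≤ ⟦ l ⟧ y z) L

_·ᶠ_ : ∀ {N} → ℚ → Form N → Form N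
s ·ᶠ l = form (λ i → s * coef l i) (s * param l) (s * constant l)

_-ᶠ_ : ∀ {N} → Form N → Form N → Form N
l -ᶠ m = form (λ i → coef l i - coef m i) (param l - param m) (constant l - constant m)

⟦·ᶠ⟧ : ∀ {N} s (l : Form N) y z → ⟦ s ·ᶠ l ⟧ y z ≡ s * ⟦ l ⟧ y z
⟦·ᶠ⟧ {N} s l y z = trans
  (cong (_+ (s * param l * z + s * constant l))
    (trans (Σ-cong N (λ i → *-assoc s (coef l i) (y i))) (Σ-* N s _)))
  (lem s _ (param l) z (constant l))
  where
  lem : ∀ s a p z c → s * a + (s * p * z + s * c) ≡ s * (a + (p * z + c))
  lem = solve-∀ ℚ-ring

⟦-ᶠ⟧ : ∀ {N} (l m : Form N) y z → ⟦ l -ᶠ m ⟧ y z ≡ ⟦ l ⟧ y z - ⟦ m ⟧ y z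
⟦-ᶠ⟧ {N} l m y z = trans
  (cong (_+ ((param l - param m) * z + (constant l - constant m)))
    (trans (Σ-cong N (λ i → distrib (coef l i) (coef m i) (y i)))
      (Σ-- N (λ i → coef l i * y i) (λ i → coef m i * y i))))
  (lem (Σℚ N (λ i → coef l i * y i)) (Σℚ N (λ i → coef m i * y i)) (param l) (param m) z (constant l) (constant m))
  where
  distrib : ∀ a b c → (a - b) * c ≡ a * c - b * c
  distrib = solve-∀ ℚ-ring
  lem : ∀ a b p q z c d → a - b + ((p - q) * z + (c - d)) ≡ a + (p * z + c) - (b + (q * z + d))
  lem = solve-∀ ℚ-ring

tailᶠ : ∀ {N} → Form (suc N) → Form N
tailᶠ l = form (coef l ∘ suc) (param l) (constant l)

⟦⟧-head : ∀ {N} (l : Form (suc N)) t y z → ⟦ l ⟧ (t ◂ y) z ≡ coef l zero * t + ⟦ tailᶠ l ⟧ y z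
⟦⟧-head l t y z = +-assoc (coef l zero * t) _ _

-- Fourier-Motzkin elimination over the rationals.

data Bound {N} (l : Form (suc N)) : Set where
  lowerBound : ∀ m → (∀ t y z → 0ℚ ≤ ⟦ l ⟧ (t ◂ y) z ⇔ ⟦ m ⟧ y z ≤ t) → Bound l
  upperBound : ∀ m → (∀ t y z → 0ℚ ≤ ⟦ l ⟧ (t ◂ y) z ⇔ t ≤ ⟦ m ⟧ y z) → Bound l
  noBound    : ∀ m → (∀ t y z → 0ℚ ≤ ⟦ l ⟧ (t ◂ y) z ⇔ 0ℚ ≤ ⟦ m ⟧ y z) → Bound l

scale⇔ : ∀ s p → 0ℚ < s → 0ℚ ≤ p ⇔ 0ℚ ≤ s * p
scale⇔ s p 0<s = mk⇔ (*-nonneg (<⇒≤ 0<s))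
  (λ h → *-cancelˡ-≤-pos s {{positive 0<s}} (subst (_≤ s * p) (sym (*-zeroʳ s)) h))

diff⇔ : ∀ p q {r} → r ≡ q - p → 0ℚ ≤ r ⇔ p ≤ q
diff⇔ p q refl = mk⇔ 0≤q-p⇒p≤q p≤q⇒0≤q-p

⇔-trans : ∀ {a b c} {A : Set a} {B : Set b} {C : Set c} → A ⇔ B → B ⇔ C → A ⇔ C
⇔-trans f g = mk⇔ (to g ∘ to f) (from f ∘ from g)

⇔-reflexive : ∀ {p q} → p ≡ q → 0ℚ ≤ p ⇔ 0ℚ ≤ q
⇔-reflexive refl = mk⇔ (λ h → h) (λ h → h)

-- Dividing by the leading coefficient isolates the variable; a negative coefficient reverses the
-- inequality, and a zero one leaves a condition on the other variables.
leadingBound : ∀ {N} (l : Form (suc N)) → Bound l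
leadingBound l with <-cmp 0ℚ (coef l zero)
... | tri< 0<c _ _ = lowerBound ((- s) ·ᶠ tailᶠ l) λ t y z →
    ⇔-trans (⇔-reflexive (⟦⟧-head l t y z)) (⇔-trans (scale⇔ s _ 0<s)
      (diff⇔ _ t (trans (lem s (coef l zero) t (⟦ tailᶠ l ⟧ y z) (*-inverseˡ (coef l zero)))
        (cong (λ x → t - x) (sym (⟦·ᶠ⟧ (- s) (tailᶠ l) y z))))))
  where
  instance
    c>0 = positive 0<c
    c≢0 = pos⇒nonZero (coef l zero)
  s = 1/ (coef l zero)
  0<s : 0ℚ < s
  0<s = positive⁻¹ s {{1/pos⇒pos (coef l zero)}}
  lem : ∀ s c t r → s * c ≡ 1ℚ → s * (c * t + r) ≡ t - (- s) * r
  lem s c t r sc≡1 = trans (lem₁ s c t r) (trans (cong (λ x → x * t - (- s) * r) sc≡1) (cong (_- (- s) * r) (*-identityˡ t)))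
    where
    lem₁ : ∀ s c t r → s * (c * t + r) ≡ s * c * t - (- s) * r
    lem₁ = solve-∀ ℚ-ring
... | tri≈ _ 0≡c _ = noBound (tailᶠ l) λ t y z →
    ⇔-reflexive (trans (⟦⟧-head l t y z) (trans (cong (λ c → c * t + ⟦ tailᶠ l ⟧ y z) (sym 0≡c))
      (trans (cong (_+ ⟦ tailᶠ l ⟧ y z) (*-zeroˡ t)) (+-identityˡ _))))
... | tri> _ _ c<0 = upperBound ((- s) ·ᶠ tailᶠ l) λ t y z →
    ⇔-trans (⇔-reflexive (⟦⟧-head l t y z)) (⇔-trans (scale⇔ (- s) _ 0<-s)
      (diff⇔ t _ (trans (lem s (coef l zero) t (⟦ tailᶠ l ⟧ y z) (*-inverseˡ (coef l zero)))
        (cong (_- t) (sym (⟦·ᶠ⟧ (- s) (tailᶠ l) y z))))))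
  where
  instance
    c>0 = negative c<0
    c≢0 = neg⇒nonZero (coef l zero)
  s = 1/ (coef l zero)
  0<-s : 0ℚ < - s
  0<-s = neg-antimono-< (negative⁻¹ s {{1/neg⇒neg (coef l zero)}})
  lem : ∀ s c t r → s * c ≡ 1ℚ → - s * (c * t + r) ≡ (- s) * r - t
  lem s c t r sc≡1 = trans (lem₁ s c t r) (trans (cong (λ x → (- s) * r - x * t) sc≡1) (cong (λ x → (- s) * r - x) (*-identityˡ t)))
    where
    lem₁ : ∀ s c t r → - s * (c * t + r) ≡ (- s) * r - s * c * t
    lem₁ = solve-∀ ℚ-ring

record Split {N} (L : List (Form (suc N))) : Set where
  field
    los ups frees : List (Form N)
    split⇔ : ∀ t y z → Holds L (t ◂ y) z ⇔
      (All (λ m → ⟦ m ⟧ y z ≤ t) los × All (λ m → t ≤ ⟦ m ⟧ y z) ups × Holds frees y z)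
open Split

split : ∀ {N} (L : List (Form (suc N))) → Split L
split [] = record { los = [] ; ups = [] ; frees = [] ; split⇔ = λ _ _ _ → mk⇔ (λ _ → [] , [] , []) (λ _ → []) }
split (l ∷ L) with leadingBound l | split L
... | lowerBound m e | S = record { los = m ∷ los S ; ups = ups S ; frees = frees S
  ; split⇔ = λ t y z → mk⇔
      (λ { (h ∷ hs) → let (p , q , r) = to (split⇔ S t y z) hs in to (e t y z) h ∷ p , q , r })
      (λ { (h ∷ p , q , r) → from (e t y z) h ∷ from (split⇔ S t y z) (p , q , r) }) }
... | upperBound m e | S = record { los = los S ; ups = m ∷ ups S ; frees = frees S
  ; split⇔ = λ t y z → mk⇔
      (λ { (h ∷ hs) → let (p , q , r) = to (split⇔ S t y z) hs in p , to (e t y z) h ∷ q , r })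
      (λ { (p , h ∷ q , r) → from (e t y z) h ∷ from (split⇔ S t y z) (p , q , r) }) }
... | noBound m e | S = record { los = los S ; ups = ups S ; frees = m ∷ frees S
  ; split⇔ = λ t y z → mk⇔
      (λ { (h ∷ hs) → let (p , q , r) = to (split⇔ S t y z) hs in p , q , to (e t y z) h ∷ r })
      (λ { (p , q , h ∷ r) → from (e t y z) h ∷ from (split⇔ S t y z) (p , q , r) }) }

-- The witness starts as 0, is lowered to every upper bound and then raised to every lower bound.
-- Raising respects the upper bounds because each lower bound lies below all of them.
between : ∀ {A : Set} (v : A → ℚ) los ups → All (λ m → All (λ u → v m ≤ v u) ups) los →
  ∃ λ t → All (λ m → v m ≤ t) los × All (λ u → t ≤ v u) ups
between v [] [] _ = 0ℚ , [] , []
between v [] (u ∷ ups) _ with between v [] ups []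
... | t , _ , q = v u ⊓ t , [] , p⊓q≤p (v u) t ∷ All.map (≤-trans (p⊓q≤q (v u) t)) q
between v (m ∷ los) ups (h ∷ hs) with between v los ups hs
... | t , p , q = v m ⊔ t , p≤p⊔q (v m) t ∷ All.map (λ le → ≤-trans le (p≤q⊔p (v m) t)) p ,
  All.zipWith (λ { (a , b) → ⊔-lub a b }) (h , q)

differences : ∀ {N} → List (Form N) → List (Form N) → List (Form N)
differences []        ups = []
differences (m ∷ los) ups = map (_-ᶠ m) ups ++ differences los ups

differences⇔ : ∀ {N} (los ups : List (Form N)) y z →
  Holds (differences los ups) y z ⇔ All (λ m → All (λ u → ⟦ m ⟧ y z ≤ ⟦ u ⟧ y z) ups) los
differences⇔ [] ups y z = mk⇔ (λ _ → []) (λ _ → [])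
differences⇔ (m ∷ los) ups y z = mk⇔
  (λ h → All.map (λ {u} → to (diff⇔ _ _ (⟦-ᶠ⟧ u m y z))) (All.map⁻ (All.++⁻ˡ _ h)) ∷
         to (differences⇔ los ups y z) (All.++⁻ʳ (map (_-ᶠ m) ups) h))
  (λ { (h ∷ hs) → All.++⁺ (All.map⁺ (All.map (λ {u} → from (diff⇔ _ _ (⟦-ᶠ⟧ u m y z))) h))
                          (from (differences⇔ los ups y z) hs) })

-- One step of Fourier–Motzkin elimination.
eliminate : ∀ {N} (L : List (Form (suc N))) →
  Σ (List (Form N)) λ L′ → ∀ y z → Holds L′ y z ⇔ ∃ λ t → Holds L (t ◂ y) z
eliminate L = frees S ++ differences (los S) (ups S) , λ y z → mk⇔
  (λ h → let (t , p , q) = between (λ m → ⟦ m ⟧ y z) (los S) (ups S)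
                              (to (differences⇔ (los S) (ups S) y z) (All.++⁻ʳ (frees S) h))
         in t , from (split⇔ S t y z) (p , q , All.++⁻ˡ (frees S) h))
  (λ { (t , h) → let (p , q , r) = to (split⇔ S t y z) h in
     All.++⁺ r (from (differences⇔ (los S) (ups S) y z)
       (All.map (λ m≤t → All.map (≤-trans m≤t) q) p)) })
  where S = split L

-- What remains are inequalities in the parameter alone, and they hold exactly for the objective
-- bounds that some point meets.
eliminate-all : ∀ N (L : List (Form N)) →
  Σ (List (Form 0)) λ L′ → ∀ y₀ z → Holds L′ y₀ z ⇔ ∃ λ y → Holds L y z
eliminate-all zero    L = L , λ y₀ z → mk⇔ (λ h → y₀ , h) proj₂
eliminate-all (suc N) L with eliminate L
... | L₁ , e₁ with eliminate-all N L₁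
... | L₂ , e₂ = L₂ , λ y₀ z → mk⇔
  (λ h → let (y , h₁) = to (e₂ y₀ z) h ; (t , h₂) = to (e₁ y z) h₁ in t ◂ y , h₂)
  (λ { (y , h) → from (e₂ y₀ z) (y ∘ suc , from (e₁ (y ∘ suc) z) (y zero , h)) })

-- The floor `a` makes the maximum exist even when there is no lower bound.
least-upper : ∀ {A : Set} (v : A → ℚ) a los → ∃ λ t → a ≤ t × All (λ m → v m ≤ t) los ×
  (∀ z → a ≤ z → All (λ m → v m ≤ z) los → t ≤ z)
least-upper v a [] = a , ≤-refl , [] , λ _ a≤z _ → a≤z
least-upper v a (m ∷ los) with least-upper v a los
... | t , a≤t , p , least = v m ⊔ t , ≤-trans a≤t (p≤q⊔p (v m) t) ,
  p≤p⊔q (v m) t ∷ All.map (λ le → ≤-trans le (p≤q⊔p (v m) t)) p ,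
  λ { z a≤z (h ∷ hs) → ⊔-lub h (least z a≤z hs) }

-- After elimination the admissible parameters form an interval. The candidate is the maximum of 0
-- and the lower bounds; the upper bounds hold at it because they hold at `z₁`, which is no smaller.
least-param : ∀ {N} (L : List (Form N)) y₁ z₁ → Holds L y₁ z₁ → (∀ y z → Holds L y z → 0ℚ ≤ z) →
  ∃ λ z → (∃ λ y → Holds L y z) × (∀ y′ z′ → Holds L y′ z′ → z ≤ z′)
least-param {N} L y₁ z₁ h₁ nonneg with eliminate-all N L
... | L₀ , e = z , to (e (λ ()) z) (back z (from (split⇔ S z y₀ 0ℚ)
      (p , All.map (≤-trans (below y₁ z₁ h₁)) q₁ , r₁))) , below
  where
  y₀ : Fin 0 → ℚ
  y₀ ()
  -- The parameter becomes the only variable, so `split` sorts the remaining conditions into lower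
  -- and upper bounds on it.
  asVar : Form 0 → Form 1
  asVar l = form (λ _ → param l) 0ℚ (constant l)
  S = split (map asVar L₀)
  lem : ∀ p z c → (p * z + 0ℚ) + (0ℚ * 0ℚ + c) ≡ 0ℚ + (p * z + c)
  lem = solve-∀ ℚ-ring
  back : ∀ z → Holds (map asVar L₀) (z ◂ y₀) 0ℚ → Holds L₀ (λ ()) z
  back z h = All.map (λ {l} → subst (0ℚ ≤_) (lem (param l) z (constant l))) (All.map⁻ h)
  forth : ∀ z → Holds L₀ (λ ()) z → Holds (map asVar L₀) (z ◂ y₀) 0ℚ
  forth z h = All.map⁺ (All.map (λ {l} → subst (0ℚ ≤_) (sym (lem (param l) z (constant l)))) h)
  parts : ∀ y′ z′ → Holds L y′ z′ → _
  parts y′ z′ h = to (split⇔ S z′ y₀ 0ℚ) (forth z′ (from (e (λ ()) z′) (y′ , h)))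
  LU = least-upper (λ m → ⟦ m ⟧ y₀ 0ℚ) 0ℚ (los S)
  z = proj₁ LU
  p = proj₁ (proj₂ (proj₂ LU))
  below : ∀ y′ z′ → Holds L y′ z′ → z ≤ z′
  below y′ z′ h = proj₂ (proj₂ (proj₂ LU)) z′ (nonneg y′ z′ h) (proj₁ (parts y′ z′ h))
  q₁ = proj₁ (proj₂ (parts y₁ z₁ h₁))
  r₁ = proj₂ (proj₂ (parts y₁ z₁ h₁))

-- Affine functions, maxima of affine functions, and the linear systems that describe them.

record Affine {N} (g : (Fin N → ℚ) → ℚ) : Set where
  constructor affine
  field
    slope     : Fin N → ℚ
    intercept : ℚ
    agree     : ∀ y → Σℚ N (λ i → slope i * y i) + intercept ≡ g y
open Affine

affine-const : ∀ {N} c → Affine {N} (λ _ → c)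
affine-const {N} c = affine (λ _ → 0ℚ) c λ y →
  trans (cong (_+ c) (trans (Σ-cong N (λ i → *-zeroˡ (y i))) (Σ-0 N))) (+-identityˡ c)

affine-coord : ∀ {N} (p : Fin N) → Affine (λ y → y p)
affine-coord p = affine (basis p) 0ℚ λ y → trans (+-identityʳ _) (Σ-basis-* p y)

affine-+ : ∀ {N} {g h : (Fin N → ℚ) → ℚ} → Affine g → Affine h → Affine (λ y → g y + h y)
affine-+ {N} a b = affine (λ i → slope a i + slope b i) (intercept a + intercept b) λ y → trans
  (cong (_+ (intercept a + intercept b)) (trans
    (Σ-cong N (λ i → *-distribʳ-+ (y i) (slope a i) (slope b i)))
    (Σ-+ N (λ i → slope a i * y i) (λ i → slope b i * y i))))
  (trans (+-interchange (Σℚ N (λ i → slope a i * y i)) _ (intercept a) (intercept b))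
    (cong₂ _+_ (agree a y) (agree b y)))

affine-* : ∀ {N} {g : (Fin N → ℚ) → ℚ} s → Affine g → Affine (λ y → s * g y)
affine-* {N} s a = affine (λ i → s * slope a i) (s * intercept a) λ y → trans
  (cong (_+ s * intercept a) (trans (Σ-cong N (λ i → *-assoc s (slope a i) (y i)))
    (Σ-* N s (λ i → slope a i * y i))))
  (trans (sym (*-distribˡ-+ s _ (intercept a))) (cong (s *_) (agree a y)))

affine-neg : ∀ {N} {g : (Fin N → ℚ) → ℚ} → Affine g → Affine (λ y → - g y)
affine-neg {g = g} a with affine-* (- 1ℚ) a
... | affine c d e = affine c d λ y → trans (e y) (lem (g y))
  where
  lem : ∀ x → - 1ℚ * x ≡ - x
  lem = solve-∀ ℚ-ring

affine-- : ∀ {N} {g h : (Fin N → ℚ) → ℚ} → Affine g → Affine h → Affine (λ y → g y - h y)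
affine-- a b = affine-+ a (affine-neg b)

affine-Σ : ∀ {N} m {g : Fin m → (Fin N → ℚ) → ℚ} → (∀ i → Affine (g i)) → Affine (λ y → Σℚ m (λ i → g i y))
affine-Σ zero    a = affine-const 0ℚ
affine-Σ (suc m) a = affine-+ (a zero) (affine-Σ m (a ∘ suc))

Polyhedral : ∀ {N} → ((Fin N → ℚ) → ℚ → Set) → Set
Polyhedral {N} P = Σ (List (Form N)) λ L → ∀ y z → Holds L y z ⇔ P y z

poly-≥0 : ∀ {N} {g : (Fin N → ℚ) → ℚ} → Affine g → Polyhedral (λ y _ → 0ℚ ≤ g y)
poly-≥0 {g = g} a = form (slope a) 0ℚ (intercept a) ∷ [] , λ y z →
  let e = trans (lem (Σℚ _ (λ i → slope a i * y i)) z (intercept a)) (agree a y) in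
  mk⇔ (λ { (h ∷ []) → subst (0ℚ ≤_) e h }) (λ h → subst (0ℚ ≤_) (sym e) h ∷ [])
  where
  lem : ∀ s z c → s + (0ℚ * z + c) ≡ s + c
  lem = solve-∀ ℚ-ring

poly-≤param : ∀ {N} {g : (Fin N → ℚ) → ℚ} → Affine g → Polyhedral (λ y z → g y ≤ z)
poly-≤param {g = g} a = form (slope b) 1ℚ (intercept b) ∷ [] , λ y z →
  let e = trans (lem (Σℚ _ (λ i → slope b i * y i)) z (intercept b)) (cong (λ x → z + x) (agree b y)) in
  mk⇔ (λ { (h ∷ []) → 0≤q-p⇒p≤q (subst (0ℚ ≤_) e h) })
      (λ h → subst (0ℚ ≤_) (sym e) (p≤q⇒0≤q-p h) ∷ [])
  where
  b = affine-neg a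
  lem : ∀ s z c → s + (1ℚ * z + c) ≡ z + (s + c)
  lem = solve-∀ ℚ-ring

poly-resp : ∀ {N} {P Q : (Fin N → ℚ) → ℚ → Set} → (∀ y z → P y z ⇔ Q y z) → Polyhedral P → Polyhedral Q
poly-resp e (L , h) = L , λ y z → ⇔-trans (h y z) (e y z)

poly-× : ∀ {N} {P Q : (Fin N → ℚ) → ℚ → Set} → Polyhedral P → Polyhedral Q → Polyhedral (λ y z → P y z × Q y z)
poly-× (L , h) (M , k) = L ++ M , λ y z → mk⇔
  (λ a → to (h y z) (All.++⁻ˡ L a) , to (k y z) (All.++⁻ʳ L a))
  (λ { (p , q) → All.++⁺ (from (h y z) p) (from (k y z) q) })

poly-∀ : ∀ {N} m {P : Fin m → (Fin N → ℚ) → ℚ → Set} → (∀ i → Polyhedral (P i)) →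
  Polyhedral (λ y z → ∀ i → P i y z)
poly-∀ zero    h = [] , λ y z → mk⇔ (λ _ ()) (λ _ → [])
poly-∀ (suc m) h = poly-resp (λ y z → mk⇔ (λ { (p , q) zero → p ; (p , q) (suc i) → q i }) (λ f → f zero , f ∘ suc))
  (poly-× (h zero) (poly-∀ m (h ∘ suc)))

poly-≡ : ∀ {N} {g : (Fin N → ℚ) → ℚ} → Affine g → ∀ c → Polyhedral (λ y _ → g y ≡ c)
poly-≡ {g = g} a c = poly-resp
  (λ y z → mk⇔ (λ { (p , q) → ≤-antisym (0≤q-p⇒p≤q p) (0≤q-p⇒p≤q q) })
               (λ e → p≤q⇒0≤q-p (≤-reflexive e) , p≤q⇒0≤q-p (≤-reflexive (sym e))))
  (poly-× (poly-≥0 (affine-- (affine-const c) a)) (poly-≥0 (affine-- a (affine-const c))))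

-- Described by the epigraph: only statements `F y ≤ z` become constraints, so the maximum of the
-- pieces is never formed.
record PiecewiseMax {N} (F : (Fin N → ℚ) → ℚ) : Set₁ where
  constructor pmax
  field
    pieces : List (Σ ((Fin N → ℚ) → ℚ) Affine)
    epi⇔   : ∀ y z → All (λ p → proj₁ p y ≤ z) pieces ⇔ F y ≤ z
open PiecewiseMax

pmax-affine : ∀ {N} {g : (Fin N → ℚ) → ℚ} → Affine g → PiecewiseMax g
pmax-affine {g = g} a = pmax ((g , a) ∷ []) λ y z → mk⇔ (λ { (h ∷ []) → h }) (_∷ [])

pmax-resp : ∀ {N} {F G : (Fin N → ℚ) → ℚ} → (∀ y → F y ≡ G y) → PiecewiseMax F → PiecewiseMax G
pmax-resp e (pmax L h) = pmax L λ y z → subst (λ x → _ ⇔ x ≤ z) (e y) (h y z)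

sumsOf : ∀ {N} → List (Σ ((Fin N → ℚ) → ℚ) Affine) → List (Σ ((Fin N → ℚ) → ℚ) Affine) →
  List (Σ ((Fin N → ℚ) → ℚ) Affine)
sumsOf []            M = []
sumsOf ((g , a) ∷ L) M = map (λ (h , b) → (λ y → g y + h y) , affine-+ a b) M ++ sumsOf L M

sumsOf⇔ : ∀ {N} (L M : List (Σ ((Fin N → ℚ) → ℚ) Affine)) y z →
  All (λ p → proj₁ p y ≤ z) (sumsOf L M) ⇔ All (λ p → All (λ q → proj₁ p y + proj₁ q y ≤ z) M) L
sumsOf⇔ [] M y z = mk⇔ (λ _ → []) (λ _ → [])
sumsOf⇔ ((g , a) ∷ L) M y z = mk⇔
  (λ h → All.map⁻ (All.++⁻ˡ _ h) ∷ to (sumsOf⇔ L M y z) (All.++⁻ʳ (map _ M) h))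
  (λ { (h ∷ hs) → All.++⁺ (All.map⁺ h) (from (sumsOf⇔ L M y z) hs) })

p+q≤r⇔q≤r-p : ∀ p q r → p + q ≤ r ⇔ q ≤ r - p
p+q≤r⇔q≤r-p p q r = mk⇔ (λ h → 0≤q-p⇒p≤q (subst (0ℚ ≤_) (lem p q r) (p≤q⇒0≤q-p h)))
                        (λ h → 0≤q-p⇒p≤q (subst (0ℚ ≤_) (sym (lem p q r)) (p≤q⇒0≤q-p h)))
  where
  lem : ∀ p q r → r - (p + q) ≡ r - p - q
  lem = solve-∀ ℚ-ring

-- If all sums of two pieces are at most z, fix the piece of `G`: the pieces of `F`, and hence `F`,
-- are at most z minus it. So every piece of `G`, and hence `G`, is at most z minus `F`.
pmax-+ : ∀ {N} {F G : (Fin N → ℚ) → ℚ} → PiecewiseMax F → PiecewiseMax G → PiecewiseMax (λ y → F y + G y)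
pmax-+ {F = F} {G} (pmax L h) (pmax M k) = pmax (sumsOf L M) λ y z → ⇔-trans (sumsOf⇔ L M y z) (mk⇔
  (λ all → from (p+q≤r⇔q≤r-p (F y) (G y) z) (to (k y _) (All.tabulate λ {q} q∈M →
     to (p+q≤r⇔q≤r-p (F y) (proj₁ q y) z) (subst (_≤ z) (+-comm (proj₁ q y) (F y))
       (from (p+q≤r⇔q≤r-p (proj₁ q y) (F y) z) (to (h y _) (All.map (λ {p} hp →
         to (p+q≤r⇔q≤r-p (proj₁ q y) (proj₁ p y) z) (subst (_≤ z) (+-comm (proj₁ p y) (proj₁ q y)) (All.lookup hp q∈M))) all)))))))
  (λ F+G≤z → All.map (λ p≤F → All.map (λ q≤G → ≤-trans (+-mono-≤ p≤F q≤G) F+G≤z) (from (k y _) ≤-refl))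
                     (from (h y _) ≤-refl)))

pmax-Σ : ∀ {N} m {F : Fin m → (Fin N → ℚ) → ℚ} → (∀ i → PiecewiseMax (F i)) → PiecewiseMax (λ y → Σℚ m (λ i → F i y))
pmax-Σ zero    h = pmax-affine (affine-const 0ℚ)
pmax-Σ (suc m) h = pmax-+ (h zero) (pmax-Σ m (h ∘ suc))

pmax-∣∣ : ∀ {N} {g : (Fin N → ℚ) → ℚ} → Affine g → PiecewiseMax (λ y → ∣ g y ∣)
pmax-∣∣ {g = g} a = pmax ((g , a) ∷ ((λ y → - g y) , affine-neg a) ∷ []) λ y z → mk⇔
  (λ { (p ∷ q ∷ []) → abs≤ (g y) p q })
  (λ h → ≤-trans (p≤∣p∣ (g y)) h ∷
         ≤-trans (subst (- g y ≤_) (∣-p∣≡∣p∣ (g y)) (p≤∣p∣ (- g y))) h ∷ [])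
  where
  abs≤ : ∀ p {z} → p ≤ z → - p ≤ z → ∣ p ∣ ≤ z
  abs≤ p p≤z -p≤z with ∣p∣≡p∨∣p∣≡-p p
  ... | inj₁ e = subst (_≤ _) (sym e) p≤z
  ... | inj₂ e = subst (_≤ _) (sym e) -p≤z

poly-≤ : ∀ {N} {F : (Fin N → ℚ) → ℚ} → PiecewiseMax F → Polyhedral (λ y z → F y ≤ z)
poly-≤ (pmax L h) = poly-resp h (go L)
  where
  go : ∀ L → Polyhedral (λ y z → All (λ p → proj₁ p y ≤ z) L)
  go []            = [] , λ y z → mk⇔ (λ _ → []) (λ _ → [])
  go ((g , a) ∷ L) = poly-resp (λ y z → mk⇔ (λ { (p , q) → p ∷ q }) (λ { (p ∷ q) → p , q }))
    (poly-× (poly-≤param a) (go L))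

-- The least z for which some feasible y has `C y ≤ z` is the minimum of `C`: the inequality is
-- tight there, since `C y` is itself such a bound.
lp-attained : ∀ {N} {P : (Fin N → ℚ) → Set} {C : (Fin N → ℚ) → ℚ} →
  Polyhedral (λ y z → P y × C y ≤ z) → (∀ y → P y → 0ℚ ≤ C y) → ∀ y₁ → P y₁ →
  ∃ λ opt → (∃ λ y → P y × C y ≡ opt) × (∀ y → P y → opt ≤ C y)
lp-attained {N} {P} {C} (L , e) C≥0 y₁ p₁ = opt , (y , py , ≤-antisym cy≤opt (lowest y py)) , lowest
  where
  holds : ∀ y → P y → Holds L y (C y)
  holds y p = from (e y (C y)) (p , ≤-refl)
  param≥0 : ∀ y z → Holds L y z → 0ℚ ≤ z
  param≥0 y z h = ≤-trans (C≥0 y (proj₁ (to (e y z) h))) (proj₂ (to (e y z) h))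
  best : ∃ λ z → (∃ λ y → Holds L y z) × (∀ y′ z′ → Holds L y′ z′ → z ≤ z′)
  best = least-param L y₁ (C y₁) (holds y₁ p₁) param≥0
  opt : ℚ
  opt = proj₁ best
  y : Fin N → ℚ
  y = proj₁ (proj₁ (proj₂ best))
  hy : Holds L y opt
  hy = proj₂ (proj₁ (proj₂ best))
  py : P y
  py = proj₁ (to (e y opt) hy)
  cy≤opt : C y ≤ opt
  cy≤opt = proj₂ (to (e y opt) hy)
  lowest : ∀ y′ → P y′ → opt ≤ C y′
  lowest y′ p′ = proj₂ (proj₂ best) y′ (C y′) (holds y′ p′)

-- The CKR relaxation as a linear system.

module _ {k} (I : Instance k) where

  private
    point : (Fin (n I ℕ.* k) → ℚ) → Fin (n I) → Fin k → ℚ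
    point y u i = y (combine u i)

    flat : (Fin (n I) → Fin k → ℚ) → Fin (n I ℕ.* k) → ℚ
    flat x p = uncurry x (remQuot k p)

    point-flat : ∀ x u i → point (flat x) u i ≡ x u i
    point-flat x u i = cong (uncurry x) (remQuot-combine u i)

    affine-point : ∀ u i → Affine (λ y → point y u i)
    affine-point u i = affine-coord (combine u i)

    costOf : (Fin (n I) → Fin k → ℚ) → List (Edge (n I)) → ℚ
    costOf x = foldr (λ e acc → w e * (½ * Σℚ k (λ i → ∣ x (u e) i - x (v e) i ∣)) + acc) 0ℚ

    costOf-cong : ∀ {x x′} → (∀ u i → x u i ≡ x′ u i) → ∀ es → costOf x es ≡ costOf x′ es
    costOf-cong h []       = refl
    costOf-cong h (e ∷ es) = cong₂ (λ s acc → w e * (½ * s) + acc)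
      (Σ-cong k (λ i → cong₂ (λ a b → ∣ a - b ∣) (h (u e) i) (h (v e) i))) (costOf-cong h es)

    feasible-cong : ∀ {x x′} → (∀ u i → x u i ≡ x′ u i) → CKRFeasible I x → CKRFeasible I x′
    feasible-cong h (p , q , r) = (λ u i → subst (0ℚ ≤_) (h u i) (p u i)) ,
      (λ u → trans (sym (Σ-cong k (h u))) (q u)) , (λ i j → trans (sym (h _ j)) (r i j))

    pmax-cost : ∀ es → All (λ e → 0ℚ ≤ w e) es → PiecewiseMax (λ y → costOf (point y) es)
    pmax-cost []       _          = pmax-affine (affine-const 0ℚ)
    pmax-cost (e ∷ es) (0≤w ∷ ws) = pmax-+
      -- The nonnegative weight moves inside the absolute value, so each summand is the absolute
      -- value of a single affine function.
      (pmax-resp (λ y → distribute (λ i → point y (u e) i - point y (v e) i))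
        (pmax-Σ k (λ i → pmax-∣∣ (affine-* (w e * ½) (affine-- (affine-point (u e) i) (affine-point (v e) i))))))
      (pmax-cost es ws)
      where
      0≤w½ : 0ℚ ≤ w e * ½
      0≤w½ = *-nonneg 0≤w (nonNegative⁻¹ ½)
      distribute : ∀ (d : Fin k → ℚ) → Σℚ k (λ i → ∣ w e * ½ * d i ∣) ≡ w e * (½ * Σℚ k (λ i → ∣ d i ∣))
      distribute d = trans (Σ-cong k (λ i → trans (∣p*q∣≡∣p∣*∣q∣ (w e * ½) (d i))
          (cong (_* ∣ d i ∣) (0≤p⇒∣p∣≡p 0≤w½))))
        (trans (Σ-* k (w e * ½) (λ i → ∣ d i ∣)) (*-assoc (w e) ½ _))

    feasible-poly : Polyhedral (λ y _ → CKRFeasible I (point y))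
    feasible-poly = poly-× (poly-∀ (n I) λ u → poly-∀ k λ i → poly-≥0 (affine-point u i))
      (poly-× (poly-∀ (n I) λ u → poly-≡ (affine-Σ k (affine-point u)) 1ℚ)
              (poly-∀ k λ i → poly-∀ k λ j → poly-≡ (affine-point (terminal I i) j) (basis i j)))

    costOf≥0 : ∀ x es → All (λ e → 0ℚ ≤ w e) es → 0ℚ ≤ costOf x es
    costOf≥0 x []       _          = ≤-refl
    costOf≥0 x (e ∷ es) (0≤w ∷ ws) = +-mono-≤
      (*-nonneg 0≤w (*-nonneg (nonNegative⁻¹ ½) (Σ≥0 k λ i → 0≤∣p∣ _))) (costOf≥0 x es ws)

  CKR-attained : ∀ x → CKRFeasible I x → ∃ (IsCKROpt I)
  CKR-attained x feas = let (opt , (y , fy , cy≡opt) , least) = lp-attained {C = λ y → costOf (point y) (edges I)}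
                              (poly-× feasible-poly (poly-≤ (pmax-cost (edges I) (weights≥0 I))))
                              (λ y _ → costOf≥0 (point y) (edges I) (weights≥0 I))
                              (flat x) (feasible-flat x feas)
    in opt , (point y , fy , cy≡opt) , λ x′ f → subst (opt ≤_) (costOf-cong (point-flat x′) (edges I))
         (least (flat x′) (feasible-flat x′ f))
    where
    feasible-flat : ∀ x → CKRFeasible I x → CKRFeasible I (point (flat x))
    feasible-flat x = feasible-cong (λ u i → sym (point-flat x u i))

-- Minimum multiway cuts

δ : ∀ {k} → Fin k → Fin k → ℚ
δ i j = 1ℚ - basis i j

foldr-cong′ : ∀ {A : Set} {s t : A → ℚ → ℚ} → (∀ e acc → s e acc ≡ t e acc) → ∀ es → foldr s 0ℚ es ≡ foldr t 0ℚ es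
foldr-cong′ h []       = refl
foldr-cong′ {t = t} h (e ∷ es) = trans (h e _) (cong (t e) (foldr-cong′ h es))

-- The step function of CutCost is local to its definition; the underscore is solved by the use in CutCost-δ.
cutStep : ∀ {k} (I : Instance k) σ e acc → _ ≡ w e * δ (σ (u e)) (σ (v e)) + acc

CutCost-δ : ∀ {k} (I : Instance k) σ → CutCost I σ ≡ foldr (λ e acc → w e * δ (σ (u e)) (σ (v e)) + acc) 0ℚ (edges I)
CutCost-δ I σ = foldr-cong′ (cutStep I σ) (edges I)

cutStep I σ e acc with σ (u e) ≟ σ (v e)
... | yes _ = sym (trans (cong (_+ acc) (*-zeroʳ (w e))) (+-identityˡ acc))
... | no  _ = cong (_+ acc) (sym (*-identityʳ (w e)))

CutCost-cong : ∀ {k} (I : Instance k) {σ τ} → (∀ x → σ x ≡ τ x) → CutCost I σ ≡ CutCost I τ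
CutCost-cong I {σ} {τ} h = trans (CutCost-δ I σ) (trans
  (foldr-cong′ (λ e acc → cong₂ (λ a b → w e * δ a b + acc) (h (u e)) (h (v e))) (edges I)) (sym (CutCost-δ I τ)))

argmin-Fin : ∀ {k} → Fin k → (f : Fin k → ℚ) → ∃ λ i → ∀ j → f i ≤ f j
argmin-Fin i₀ f = argmin f i₀ (allFin _) , λ j → All.lookup (f[argmin]≤f[xs] {f = f} i₀ (allFin _)) (∈-allFin j)

-- The hypothesis on pointwise equal arguments stands in for function extensionality when a
-- labelling is rebuilt from its head and tail.
argmin-→ : ∀ n {k} → (Fin n → Fin k) → (F : (Fin n → Fin k) → ℚ) →
  (∀ {σ τ} → (∀ x → σ x ≡ τ x) → F σ ≡ F τ) → ∃ λ σ → ∀ τ → F σ ≤ F τ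
argmin-→ zero    σ₀ F ext = σ₀ , λ τ → ≤-reflexive (ext λ ())
argmin-→ (suc n) σ₀ F ext = c ◂ proj₁ (best c) , λ τ →
  ≤-trans (proj₂ outer (τ zero)) (≤-trans (proj₂ (best (τ zero)) (τ ∘ suc))
    (≤-reflexive (ext λ { zero → refl ; (suc x) → refl })))
  where
  best = λ c → argmin-→ n (σ₀ ∘ suc) (λ σ → F (c ◂ σ)) (λ h → ext λ { zero → refl ; (suc x) → h x })
  outer = argmin-Fin (σ₀ zero) (λ c → F (c ◂ proj₁ (best c)))
  c = proj₁ outer

module _ {k} (I : Instance k) where

  private
    -- Overwriting the labels of the terminals turns every labelling into a multiway cut and leaves
    -- multiway cuts unchanged, so the minimum may be taken over all labellings.
    force : (Fin (n I) → Fin k) → Fin (n I) → Fin k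
    force σ x with any? (λ i → terminal I i ≟ x)
    ... | yes (i , _) = i
    ... | no _        = σ x

    force-cong : ∀ {σ τ} → (∀ x → σ x ≡ τ x) → ∀ x → force σ x ≡ force τ x
    force-cong h x with any? (λ i → terminal I i ≟ x)
    ... | yes _ = refl
    ... | no _  = h x

    force-cut : ∀ σ → IsMultiwayCut I (force σ)
    force-cut σ j with any? (λ i → terminal I i ≟ terminal I j)
    ... | yes (i , e) = terminals-distinct I e
    ... | no ∄        with () ← ∄ (j , refl)

    force-id : ∀ σ → IsMultiwayCut I σ → ∀ x → force σ x ≡ σ x
    force-id σ cut x with any? (λ i → terminal I i ≟ x)
    ... | yes (i , refl) = sym (cut i)
    ... | no _           = refl

  minimum-cut : (Fin (n I) → Fin k) → ∃ (IsIntOpt I)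
  minimum-cut σ₀ with argmin-→ (n I) σ₀ (CutCost I ∘ force) (CutCost-cong I ∘ force-cong)
  ... | σ , least = CutCost I (force σ) , (force σ , force-cut σ , refl) , λ τ cut →
    ≤-trans (least τ) (≤-reflexive (CutCost-cong I (force-id τ cut)))

-- Cuts of a labelled rhombus and hexagon

triangle : ∀ {X : Set} → (X → X → ℚ) → X → X → X → ℚ
triangle D x y z = D x y + D y z + D z x

fan : ∀ {X : Set} → (X → X → ℚ) → X → X → X → ℚ
fan D t x y = 2ℚ * D t x + 2ℚ * D t y + D x y

module _ {X : Set} (D : X → X → ℚ) (q : ℕ) where

  -- Each small triangle pays for all its three edges, so an edge between two triangles counts
  -- twice. The edges on the outer boundary receive their second copy from `fanCost` and `sideCost`.
  meshCost sideCost : (ℕ → ℕ → X) → ℚ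
  meshCost P = ∑ q λ a → ∑ q λ b →
    triangle D (P a b) (P a (suc b)) (P (suc a) (suc b)) + triangle D (P a b) (P (suc a) (suc b)) (P (suc a) b)
  sideCost P = ∑ q λ b → D (P q b) (P q (suc b))

  -- A hexagon consists of three rhombi around its center.  In the rhombus of (i, j, l) the point (a, b)
  -- is ((q + b) eⁱ + (q + a - b) eʲ + (q - a) eˡ) / 3 q, so that a = q is the side on the edge eⁱ eʲ and
  -- b = q is the side with i-th coordinate 2/3; t is the terminal i.
  fanCost rhombusCost : X → (ℕ → ℕ → X) → ℚ
  fanCost t P = ∑ q λ a → fan D t (P a q) (P (suc a) q)
  rhombusCost t P = meshCost P + fanCost t P + sideCost P

-- The labels 0, 1, 2 are the terminals i, j, l of the rhombus, 3 is any other terminal.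
Label : Set
Label = Fin 4

-- On the side a = q only the potential of 2 varies, on the side b = q only that of 0: foreign labels are
-- penalised on the former and the star pays for missing labels 0 on the latter.
potential : Label → ℕ → ℕ → ℚ
potential 0F a b = ι (a ℕ.⊔ b) - 2ℚ * ι a
potential 1F a b = ι (a ℕ.⊔ b)
potential 2F a b = ι (a ℕ.⊔ b) - 2ℚ * ι b
potential 3F a b = 0ℚ

-- Without this correction a triangle with the three labels 0, 1, 2 can exceed its number of cut edges.
twist : Label → Label → ℚ
twist 0F 1F = - 1ℚ
twist 1F 2F = - 1ℚ
twist 2F 0F = - 1ℚ
twist 1F 0F = 1ℚ
twist 2F 1F = 1ℚ
twist 0F 2F = 1ℚ
twist _  _  = 0ℚ

-- Up to the twist, twice the difference between the two labels of the potential averaged over the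
-- two endpoints. The averaging makes it change sign with the direction of travel.
jump : (α β : Label → ℚ) → Label → Label → ℚ
jump α β x y = α y + β y - α x - β x + twist x y

twist-anti : ∀ x y → twist y x ≡ - twist x y
twist-anti = from-yes (all? λ x → all? λ y → twist y x ℚₚ.≟ - twist x y)

-- Adjacent triangles traverse their common edge in opposite directions, so this is what makes
-- interior edges cancel in the Stokes formula.
jump-anti : ∀ α β x y → jump β α y x ≡ - jump α β x y
jump-anti α β x y = trans (cong (β x + α x - β y - α y +_) (twist-anti x y))
  (lem (α x) (α y) (β x) (β y) (twist x y))
  where
  lem : ∀ ax ay bx by k → bx + ax - by - ay + - k ≡ - (ay + by - ax - bx + k)
  lem = solve-∀ ℚ-ring

offset : ℚ → ℚ → ℚ → Label → ℚ
offset m a b 0F = m - 2ℚ * a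
offset m a b 1F = m
offset m a b 2F = m - 2ℚ * b
offset m a b 3F = 0ℚ

-- The sum of the jumps around a triangle whose potentials are `α`, `α + d` and `α + e`: `α`
-- cancels, so the position in the grid disappears and 64 label triples remain.
Calibrated : (d e : Label → ℚ) → Set
Calibrated d e = ∀ x y z → (d z - d x) + (e x - e y) + (twist x y + twist y z + twist z x) ≤ triangle δ x y z

calibrated? : ∀ d e → Dec (Calibrated d e)
calibrated? d e = all? λ x → all? λ y → all? λ z →
  (d z - d x) + (e x - e y) + (twist x y + twist y z + twist z x) ≤? triangle δ x y z

-- The term `a ⊔ b` bends along the diagonal of the rhombus, so upper and lower triangles each occur
-- with two pairs of offsets. The subscript is the growth of `a ⊔ b` from `(a, b)` to the vertex off
-- the diagonal of the cell.
upper₁ : Calibrated (offset 1ℚ 0ℚ 1ℚ) (offset 1ℚ 1ℚ 1ℚ)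
upper₁ = from-yes (calibrated? (offset 1ℚ 0ℚ 1ℚ) (offset 1ℚ 1ℚ 1ℚ))

upper₀ : Calibrated (offset 0ℚ 0ℚ 1ℚ) (offset 1ℚ 1ℚ 1ℚ)
upper₀ = from-yes (calibrated? (offset 0ℚ 0ℚ 1ℚ) (offset 1ℚ 1ℚ 1ℚ))

lower₁ : Calibrated (offset 1ℚ 1ℚ 1ℚ) (offset 1ℚ 1ℚ 0ℚ)
lower₁ = from-yes (calibrated? (offset 1ℚ 1ℚ 1ℚ) (offset 1ℚ 1ℚ 0ℚ))

lower₀ : Calibrated (offset 1ℚ 1ℚ 1ℚ) (offset 0ℚ 1ℚ 0ℚ)
lower₀ = from-yes (calibrated? (offset 1ℚ 1ℚ 1ℚ) (offset 0ℚ 1ℚ 0ℚ))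

Shifted : (α β d : Label → ℚ) → Set
Shifted α β d = ∀ x → β x ≡ α x + d x

triangle-jumps : ∀ {α β γ d e} → Shifted α β d → Shifted α γ e → Calibrated d e → ∀ x y z →
  jump α β x y + jump β γ y z + jump γ α z x ≤ triangle δ x y z
triangle-jumps {α} {β} {γ} {d} {e} sβ sγ cal x y z = subst (_≤ triangle δ x y z) (sym (trans
  (cong₂ _+_ (cong₂ _+_ (cong₂ (λ p q → α y + p - α x - q + twist x y) (sβ y) (sβ x))
      (cong₄ (λ p q r s → p + q - r - s + twist y z) (sβ z) (sγ z) (sβ y) (sγ y)))
    (cong₂ (λ p q → p + α x - q - α z + twist z x) (sγ x) (sγ z)))
  (lem (α x) (α y) (α z) (d x) (d y) (d z) (e x) (e y) (e z) (twist x y) (twist y z) (twist z x))))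
  (cal x y z)
  where
  cong₄ : ∀ (f : ℚ → ℚ → ℚ → ℚ → ℚ) {a a′ b b′ c c′ g g′} → a ≡ a′ → b ≡ b′ → c ≡ c′ → g ≡ g′ → f a b c g ≡ f a′ b′ c′ g′
  cong₄ f refl refl refl refl = refl
  lem : ∀ ax ay az dx dy dz ex ey ez k l m →
    (ay + (ay + dy) - ax - (ax + dx) + k)
    + ((az + dz) + (az + ez) - (ay + dy) - (ay + ey) + l)
    + ((ax + ex) + ax - (az + ez) - az + m) ≡ (dz - dx) + (ex - ey) + (k + l + m)
  lem = solve-∀ ℚ-ring

potential-shift : ∀ a b a′ b′ {m da db} → ι (a′ ℕ.⊔ b′) ≡ ι (a ℕ.⊔ b) + m → ι a′ ≡ ι a + da → ι b′ ≡ ι b + db →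
  Shifted (λ x → potential x a b) (λ x → potential x a′ b′) (offset m da db)
potential-shift a b a′ b′ {m} {da} {db} em ea eb = λ where
    0F → trans (cong₂ (λ p q → p - 2ℚ * q) em ea) (lem (ι (a ℕ.⊔ b)) m (ι a) da)
    1F → em
    2F → trans (cong₂ (λ p q → p - 2ℚ * q) em eb) (lem (ι (a ℕ.⊔ b)) m (ι b) db)
    3F → refl
  where
  lem : ∀ p m a d → p + m - 2ℚ * (a + d) ≡ (p - 2ℚ * a) + (m - 2ℚ * d)
  lem = solve-∀ ℚ-ring

ι-stay : ∀ {m n} → m ≡ n → ι m ≡ ι n + 0ℚ
ι-stay {n = n} refl = sym (+-identityʳ (ι n))

ι-step : ∀ {m n} → m ≡ suc n → ι m ≡ ι n + 1ℚ
ι-step {n = n} refl = +-comm 1ℚ (ι n)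

-- The discrete Stokes formula on a rhombus.

module _ (F : ℕ → ℕ → Label) where

  potentialAt : ℕ → ℕ → Label → ℚ
  potentialAt a b x = potential x a b

  value : ℕ → ℕ → ℚ
  value a b = potential (F a b) a b

  upJump rightJump : ℕ → ℕ → ℚ
  upJump    a b = jump (potentialAt a b) (potentialAt a (suc b)) (F a b) (F a (suc b))
  rightJump a b = jump (potentialAt a b) (potentialAt (suc a) b) (F a b) (F (suc a) b)

  private
    upperTriangle : ∀ a b → upJump a b + rightJump a (suc b) + jump (potentialAt (suc a) (suc b)) (potentialAt a b) (F (suc a) (suc b)) (F a b)
      ≤ triangle δ (F a b) (F a (suc b)) (F (suc a) (suc b))
    upperTriangle a b with ℕₚ.≤-<-connex a b
    ... | inj₁ a≤b = triangle-jumps {potentialAt a b} {potentialAt a (suc b)} {potentialAt (suc a) (suc b)}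
      (potential-shift a b a (suc b) (ι-step (trans (ℕₚ.m≤n⇒m⊔n≡n (ℕₚ.m≤n⇒m≤1+n a≤b)) (cong suc (sym (ℕₚ.m≤n⇒m⊔n≡n a≤b))))) (ι-stay {a} refl) (ι-step {suc b} refl))
      (potential-shift a b (suc a) (suc b) (ι-step {suc a ℕ.⊔ suc b} refl) (ι-step {suc a} refl) (ι-step {suc b} refl))
      upper₁ (F a b) (F a (suc b)) (F (suc a) (suc b))
    ... | inj₂ b<a = triangle-jumps {potentialAt a b} {potentialAt a (suc b)} {potentialAt (suc a) (suc b)}
      (potential-shift a b a (suc b) (ι-stay (trans (ℕₚ.m≥n⇒m⊔n≡m b<a) (sym (ℕₚ.m≥n⇒m⊔n≡m (ℕₚ.<⇒≤ b<a))))) (ι-stay {a} refl) (ι-step {suc b} refl))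
      (potential-shift a b (suc a) (suc b) (ι-step {suc a ℕ.⊔ suc b} refl) (ι-step {suc a} refl) (ι-step {suc b} refl))
      upper₀ (F a b) (F a (suc b)) (F (suc a) (suc b))

    lowerTriangle : ∀ a b → jump (potentialAt a b) (potentialAt (suc a) (suc b)) (F a b) (F (suc a) (suc b))
        + jump (potentialAt (suc a) (suc b)) (potentialAt (suc a) b) (F (suc a) (suc b)) (F (suc a) b)
        + jump (potentialAt (suc a) b) (potentialAt a b) (F (suc a) b) (F a b)
      ≤ triangle δ (F a b) (F (suc a) (suc b)) (F (suc a) b)
    lowerTriangle a b with ℕₚ.≤-<-connex b a
    ... | inj₁ b≤a = triangle-jumps {potentialAt a b} {potentialAt (suc a) (suc b)} {potentialAt (suc a) b}
      (potential-shift a b (suc a) (suc b) (ι-step {suc a ℕ.⊔ suc b} refl) (ι-step {suc a} refl) (ι-step {suc b} refl))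
      (potential-shift a b (suc a) b (ι-step (trans (ℕₚ.m≥n⇒m⊔n≡m (ℕₚ.m≤n⇒m≤1+n b≤a)) (cong suc (sym (ℕₚ.m≥n⇒m⊔n≡m b≤a))))) (ι-step {suc a} refl) (ι-stay {b} refl))
      lower₁ (F a b) (F (suc a) (suc b)) (F (suc a) b)
    ... | inj₂ a<b = triangle-jumps {potentialAt a b} {potentialAt (suc a) (suc b)} {potentialAt (suc a) b}
      (potential-shift a b (suc a) (suc b) (ι-step {suc a ℕ.⊔ suc b} refl) (ι-step {suc a} refl) (ι-step {suc b} refl))
      (potential-shift a b (suc a) b (ι-stay (trans (ℕₚ.m≤n⇒m⊔n≡n a<b) (sym (ℕₚ.m≤n⇒m⊔n≡n (ℕₚ.<⇒≤ a<b))))) (ι-step {suc a} refl) (ι-stay {b} refl))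
      lower₀ (F a b) (F (suc a) (suc b)) (F (suc a) b)

    -- The two triangles traverse the diagonal in opposite directions; only the circulation around
    -- the cell is left.
    cell : ∀ a b → (upJump a b - upJump (suc a) b) + (rightJump a (suc b) - rightJump a b)
      ≤ triangle δ (F a b) (F a (suc b)) (F (suc a) (suc b)) + triangle δ (F a b) (F (suc a) (suc b)) (F (suc a) b)
    cell a b = ≤-trans (≤-reflexive (sym (trans
      (cong₂ _+_
        (cong (upJump a b + rightJump a (suc b) +_) (jump-anti (potentialAt a b) (potentialAt (suc a) (suc b)) (F a b) (F (suc a) (suc b))))
        (cong₂ (λ p q → diag + p + q) (jump-anti (potentialAt (suc a) b) (potentialAt (suc a) (suc b)) (F (suc a) b) (F (suc a) (suc b)))
          (jump-anti (potentialAt a b) (potentialAt (suc a) b) (F a b) (F (suc a) b))))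
      (lem (upJump a b) (rightJump a (suc b)) diag (upJump (suc a) b) (rightJump a b)))))
      (+-mono-≤ (upperTriangle a b) (lowerTriangle a b))
      where
      diag = jump (potentialAt a b) (potentialAt (suc a) (suc b)) (F a b) (F (suc a) (suc b))
      lem : ∀ u r d u′ r′ → (u + r + - d) + (d + - u′ + - r′) ≡ (u - u′) + (r - r′)
      lem = solve-∀ ℚ-ring

    cells : ∀ q → ∑ q (λ b → upJump 0 b - upJump q b) + ∑ q (λ a → rightJump a q - rightJump a 0) ≤
      meshCost δ q F
    cells q = ≤-trans (≤-reflexive (sym (trans
        (trans (Σ-cong q λ i → Σ-+ q (λ j → upJump (toℕ i) (toℕ j) - upJump (suc (toℕ i)) (toℕ j)) _)
               (Σ-+ q (λ i → ∑ q (λ b → upJump (toℕ i) b - upJump (suc (toℕ i)) b)) _))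
        (cong₂ _+_
          (trans (Σ-swap q q (λ i j → upJump (toℕ i) (toℕ j) - upJump (suc (toℕ i)) (toℕ j)))
                 (Σ-cong q λ j → anti-telescope q (λ a → upJump a (toℕ j))))
          (Σ-cong q λ i → ∑-telescope q (rightJump (toℕ i)))))))
      (Σ-mono q λ i → Σ-mono q λ j → cell (toℕ i) (toℕ j))
      where
      anti-telescope : ∀ m (f : ℕ → ℚ) → ∑ m (λ a → f a - f (suc a)) ≡ f 0 - f m
      anti-telescope m f = trans (Σ-cong m (λ i → swap (f (toℕ i)) (f (suc (toℕ i)))))
        (trans (Σ-neg m (λ i → f (suc (toℕ i)) - f (toℕ i)))
          (trans (cong -_ (∑-telescope m f)) (sym (swap (f 0) (f m)))))
        where
        swap : ∀ x y → x - y ≡ - (y - x)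
        swap = solve-∀ ℚ-ring

    -- The first part is a difference of `value` and telescopes along a side; the second depends on
    -- the two labels only and is compared with the cost of one boundary segment.
    jump-shifted : ∀ {α β d} → Shifted α β d → ∀ x y →
      jump α β x y ≡ 2ℚ * (β y - α x) + (twist x y - d x - d y)
    jump-shifted {α} {β} {d} sh x y = trans (cong₂ (λ p q → α y + p - α x - q + twist x y) (sh y) (sh x))
      (trans (lem (α x) (α y) (d x) (d y) (twist x y)) (cong (λ p → 2ℚ * (p - α x) + (twist x y - d x - d y)) (sym (sh y))))
      where
      lem : ∀ ax ay dx dy k → ay + (ay + dy) - ax - (ax + dx) + k ≡ 2ℚ * (ay + dy - ax) + (k - dx - dy)
      lem = solve-∀ ℚ-ring

    -- On this side each step lowers the potential of 0 by 2, which yields 2 for each endpoint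
    -- labelled 0. The spokes of weight 2 yield 2 for each other endpoint, so together they give 4,
    -- and the twist is covered by the cut of the segment itself.
    fan-check : ∀ x y → 4ℚ ≤ twist x y - offset 0ℚ 1ℚ 0ℚ x - offset 0ℚ 1ℚ 0ℚ y + fan δ 0F x y
    fan-check = from-yes (all? λ x → all? λ y →
      4ℚ ≤? twist x y - offset 0ℚ 1ℚ 0ℚ x - offset 0ℚ 1ℚ 0ℚ y + fan δ 0F x y)

    -- Here only the potential of 2 drops, so each endpoint with the foreign label 2 loses 2; the
    -- twist is again covered by the cut of the segment.
    side-check : ∀ x y → twist x y - offset 0ℚ 0ℚ 1ℚ x - offset 0ℚ 0ℚ 1ℚ y ≤ 2ℚ * (basis 2F x + basis 2F y) + δ x y
    side-check = from-yes (all? λ x → all? λ y →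
      twist x y - offset 0ℚ 0ℚ 1ℚ x - offset 0ℚ 0ℚ 1ℚ y ≤? 2ℚ * (basis 2F x + basis 2F y) + δ x y)

    fan-bound : ∀ q (i : Fin q) → let a = toℕ i in
      2ℚ * (value (suc a) q - value a q) + 4ℚ ≤ rightJump a q + fan δ 0F (F a q) (F (suc a) q)
    fan-bound q i = ≤-trans (+-monoʳ-≤ (2ℚ * (value (suc a) q - value a q)) (fan-check (F a q) (F (suc a) q)))
      (≤-reflexive (trans (sym (+-assoc (2ℚ * (value (suc a) q - value a q)) _ (fan δ 0F (F a q) (F (suc a) q))))
        (cong (_+ fan δ 0F (F a q) (F (suc a) q)) (sym (jump-shifted {potentialAt a q} {potentialAt (suc a) q} {offset 0ℚ 1ℚ 0ℚ}
          (potential-shift a q (suc a) q (ι-stay (trans (ℕₚ.m≤n⇒m⊔n≡n a<q) (sym (ℕₚ.m≤n⇒m⊔n≡n (ℕₚ.<⇒≤ a<q))))) (ι-step {suc a} refl) (ι-stay {q} refl))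
          (F a q) (F (suc a) q))))))
      where
      a = toℕ i
      a<q = toℕ<n i

    side-bound : ∀ q (i : Fin q) → let b = toℕ i in
      upJump q b - 2ℚ * (value q (suc b) - value q b) ≤ 2ℚ * (basis 2F (F q b) + basis 2F (F q (suc b))) + δ (F q b) (F q (suc b))
    side-bound q i = ≤-trans (≤-reflexive (trans
        (cong (_- 2ℚ * (value q (suc b) - value q b)) (jump-shifted {potentialAt q b} {potentialAt q (suc b)} {offset 0ℚ 0ℚ 1ℚ}
          (potential-shift q b q (suc b) (ι-stay (trans (ℕₚ.m≥n⇒m⊔n≡m b<q) (sym (ℕₚ.m≥n⇒m⊔n≡m (ℕₚ.<⇒≤ b<q))))) (ι-stay {q} refl) (ι-step {suc b} refl))
          (F q b) (F q (suc b))))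
        (lem (2ℚ * (value q (suc b) - value q b)) _)))
      (side-check (F q b) (F q (suc b)))
      where
      b = toℕ i
      b<q = toℕ<n i
      lem : ∀ x y → x + y - x ≡ y
      lem = solve-∀ ℚ-ring

  -- The jumps along an axis together with the end value that telescoping along the adjacent outer
  -- side leaves at the tip of that axis.
  outflow inflow : ℕ → ℚ
  outflow q = ∑ q (upJump 0) - 2ℚ * value 0 q
  inflow  q = ∑ q (λ a → rightJump a 0) - 2ℚ * value q 0

  -- Stokes on the mesh, plus the bounds on the two outer sides. Their telescoped values at the
  -- common corner `(q, q)` cancel, and the terms at the two other ends go into `outflow` and
  -- `inflow`.
  rhombus-bound : ∀ q B → (∀ b → b ℕ.≤ q → basis 2F (F q b) ≤ B) →
    outflow q - inflow q + 4ℚ * ι q * (1ℚ - B) ≤ rhombusCost δ q 0F F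
  rhombus-bound q B foreign≤B = 0≤q-p⇒p≤q (subst (0ℚ ≤_)
    (lem (∑ q (upJump 0)) (∑ q (upJump q)) (∑ q (λ a → rightJump a q)) (∑ q (λ a → rightJump a 0))
      (value q q) (value 0 q) (value q 0) (ι q) B (meshCost δ q F) (fanCost δ q 0F F) (sideCost δ q F))
    (+-mono-≤ (+-mono-≤ (p≤q⇒0≤q-p cells′) (p≤q⇒0≤q-p fans)) (p≤q⇒0≤q-p sides)))
    where
    cells′ : (∑ q (upJump 0) - ∑ q (upJump q)) + (∑ q (λ a → rightJump a q) - ∑ q (λ a → rightJump a 0)) ≤ meshCost δ q F
    cells′ = ≤-trans (≤-reflexive (sym (cong₂ _+_ (Σ-- q (upJump 0 ∘ toℕ) (upJump q ∘ toℕ))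
      (Σ-- q (λ i → rightJump (toℕ i) q) (λ i → rightJump (toℕ i) 0))))) (cells q)
    fans : 2ℚ * (value q q - value 0 q) + ι q * 4ℚ ≤ ∑ q (λ a → rightJump a q) + fanCost δ q 0F F
    fans = ≤-trans (≤-reflexive (sym (trans (Σ-+ q (λ i → 2ℚ * (value (suc (toℕ i)) q - value (toℕ i) q)) (λ _ → 4ℚ))
        (cong₂ _+_ (trans (Σ-* q 2ℚ (λ i → value (suc (toℕ i)) q - value (toℕ i) q)) (cong (2ℚ *_) (∑-telescope q (λ a → value a q)))) (Σ-const q 4ℚ)))))
      (≤-trans (Σ-mono q (fan-bound q)) (≤-reflexive (Σ-+ q (λ i → rightJump (toℕ i) q) _)))
    sides : ∑ q (upJump q) - 2ℚ * (value q q - value q 0) ≤ ι q * (4ℚ * B) + sideCost δ q F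
    sides = ≤-trans (≤-reflexive (sym (trans (Σ-- q (upJump q ∘ toℕ) (λ i → 2ℚ * (value q (suc (toℕ i)) - value q (toℕ i))))
        (cong (λ x → ∑ q (upJump q) - x) (trans (Σ-* q 2ℚ (λ i → value q (suc (toℕ i)) - value q (toℕ i))) (cong (2ℚ *_) (∑-telescope q (value q))))))))
      (≤-trans (Σ-mono q (λ i → ≤-trans (side-bound q i) (+-monoˡ-≤ (δ (F q (toℕ i)) (F q (suc (toℕ i)))) (foreign i))))
        (≤-reflexive (trans (Σ-+ q (λ _ → 4ℚ * B) (λ i → δ (F q (toℕ i)) (F q (suc (toℕ i))))) (cong (_+ sideCost δ q F) (Σ-const q (4ℚ * B))))))
      where
      foreign : (i : Fin q) → 2ℚ * (basis 2F (F q (toℕ i)) + basis 2F (F q (suc (toℕ i)))) ≤ 4ℚ * B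
      foreign i = ≤-trans (*-monoˡ (nonNegative⁻¹ 2ℚ) (+-mono-≤ (foreign≤B (toℕ i) (ℕₚ.<⇒≤ (toℕ<n i))) (foreign≤B (suc (toℕ i)) (toℕ<n i))))
        (≤-reflexive (dbl B))
        where
        dbl : ∀ B → 2ℚ * (B + B) ≡ 4ℚ * B
        dbl = solve-∀ ℚ-ring
    lem : ∀ u₀ uq rq r₀ vqq v0q vq0 n B c f s →
      (c - ((u₀ - uq) + (rq - r₀))) + (rq + f - (2ℚ * (vqq - v0q) + n * 4ℚ)) + (n * (4ℚ * B) + s - (uq - 2ℚ * (vqq - vq0)))
      ≡ c + f + s - (u₀ - 2ℚ * v0q - (r₀ - 2ℚ * vq0) + 4ℚ * n * (1ℚ - B))
    lem = solve-∀ ℚ-ring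

-- Gluing three rhombi into a hexagon.

rotate : Label → Label
rotate 0F = 2F
rotate 1F = 0F
rotate 2F = 1F
rotate 3F = 3F

twist-rotate : ∀ x y → twist (rotate x) (rotate y) ≡ twist x y
twist-rotate = from-yes (all? λ x → all? λ y → twist (rotate x) (rotate y) ℚₚ.≟ twist x y)

-- The next rhombus is that of (j, l, i), so its labels are the rotated ones, and the point `(b, 0)`
-- on the common axis is its point `(0, b)`. The potentials agree there.
potential-rotate : ∀ x b → potential (rotate x) 0 b ≡ potential x b 0
potential-rotate 0F b = cong (λ m → ι m - 2ℚ * ι b) (sym (ℕₚ.⊔-identityʳ b))
potential-rotate 1F b = trans (lem (ι b)) (cong ι (sym (ℕₚ.⊔-identityʳ b)))
  where
  lem : ∀ x → x - 2ℚ * 0ℚ ≡ x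
  lem = solve-∀ ℚ-ring
potential-rotate 2F b = trans (cong ι (sym (ℕₚ.⊔-identityʳ b))) (lem (ι (b ℕ.⊔ 0)))
  where
  lem : ∀ x → x ≡ x - 2ℚ * 0ℚ
  lem = solve-∀ ℚ-ring
potential-rotate 3F b = refl

outflow-inflow : ∀ F F′ → (∀ b → F′ 0 b ≡ rotate (F b 0)) → ∀ q → outflow F′ q ≡ inflow F q
outflow-inflow F F′ glue q = cong₂ (λ s x → s - 2ℚ * x) (Σ-cong q (λ i → edgewise (toℕ i)))
  (trans (cong (λ x → potential x 0 q) (glue q)) (potential-rotate (F q 0) q))
  where
  edgewise : ∀ b → upJump F′ 0 b ≡ rightJump F b 0
  edgewise b rewrite glue b | glue (suc b) | potential-rotate (F b 0) b | potential-rotate (F b 0) (suc b)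
    | potential-rotate (F (suc b) 0) b | potential-rotate (F (suc b) 0) (suc b) | twist-rotate (F b 0) (F (suc b) 0) = refl

-- The outflow of each rhombus is the inflow of the one before it, so around the center these terms
-- cancel cyclically.
hexagon-bound : ∀ q (F₀ F₁ F₂ : ℕ → ℕ → Label) →
  (∀ b → F₁ 0 b ≡ rotate (F₀ b 0)) → (∀ b → F₂ 0 b ≡ rotate (F₁ b 0)) → (∀ b → F₀ 0 b ≡ rotate (F₂ b 0)) →
  ∀ {B₀ B₁ B₂} → (∀ b → b ℕ.≤ q → basis 2F (F₀ q b) ≤ B₀) → (∀ b → b ℕ.≤ q → basis 2F (F₁ q b) ≤ B₁) →
  (∀ b → b ℕ.≤ q → basis 2F (F₂ q b) ≤ B₂) →
  4ℚ * ι q * ((1ℚ - B₀) + (1ℚ - B₁) + (1ℚ - B₂)) ≤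
    rhombusCost δ q 0F F₀ + rhombusCost δ q 0F F₁ + rhombusCost δ q 0F F₂
hexagon-bound q F₀ F₁ F₂ g₁ g₂ g₀ {B₀} {B₁} {B₂} b₀ b₁ b₂ = ≤-trans
  (≤-reflexive (trans (lem (inflow F₀ q) (inflow F₁ q) (inflow F₂ q) (4ℚ * ι q) (1ℚ - B₀) (1ℚ - B₁) (1ℚ - B₂))
    (sym (cong₃ (λ x y z → (x - inflow F₀ q + 4ℚ * ι q * (1ℚ - B₀)) + (y - inflow F₁ q + 4ℚ * ι q * (1ℚ - B₁)) + (z - inflow F₂ q + 4ℚ * ι q * (1ℚ - B₂)))
      (outflow-inflow F₂ F₀ g₀ q) (outflow-inflow F₀ F₁ g₁ q) (outflow-inflow F₁ F₂ g₂ q)))))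
  (+-mono-≤ (+-mono-≤ (rhombus-bound F₀ q B₀ b₀) (rhombus-bound F₁ q B₁ b₁)) (rhombus-bound F₂ q B₂ b₂))
  where
  cong₃ : ∀ (f : ℚ → ℚ → ℚ → ℚ) {a a′ b b′ c c′} → a ≡ a′ → b ≡ b′ → c ≡ c′ → f a b c ≡ f a′ b′ c′
  cong₃ f refl refl refl = refl
  lem : ∀ i₀ i₁ i₂ n x y z → n * (x + y + z) ≡ (i₂ - i₀ + n * x) + (i₀ - i₁ + n * y) + (i₁ - i₂ + n * z)
  lem = solve-∀ ℚ-ring

-- Edge lists and their costs

δ-≡ : ∀ {k} {i j : Fin k} → i ≡ j → δ i j ≡ 0ℚ
δ-≡ {i = i} refl = cong (λ x → 1ℚ - x) (basis-refl i)

δ-≢ : ∀ {k} {i j : Fin k} → i ≢ j → δ i j ≡ 1ℚ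
δ-≢ i≢j = cong (λ x → 1ℚ - x) (basis-≢ i≢j)

δ≤1 : ∀ {k} (i j : Fin k) → δ i j ≤ 1ℚ
δ≤1 i j with i ≟ j
... | yes _ = 0≤1
... | no _  = ≤-refl

Distinct : ∀ {k} → Fin k → Fin k → Fin k → Set
Distinct i j l = i ≢ j × j ≢ l × l ≢ i

distinct? : ∀ {k} (i j l : Fin k) → Dec (Distinct i j l)
distinct? i j l = ¬? (i ≟ j) ×-dec ¬? (j ≟ l) ×-dec ¬? (l ≟ i)

-- A product of indicators, so that a factor not involving the summation index can be pulled out of
-- a sum.
χ : ∀ {k} → Fin k → Fin k → Fin k → ℚ
χ i j l = δ i j * (δ j l * δ l i)

χ-distinct : ∀ {k} {i j l : Fin k} → Distinct i j l → χ i j l ≡ 1ℚ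
χ-distinct (i≢j , j≢l , l≢i) = cong₂ _*_ (δ-≢ i≢j) (cong₂ _*_ (δ-≢ j≢l) (δ-≢ l≢i))

χ-degenerate : ∀ {k} {i j l : Fin k} → ¬ Distinct i j l → χ i j l ≡ 0ℚ
χ-degenerate {i = i} {j} {l} ¬d = go (i ≟ j) (j ≟ l) (l ≟ i)
  where
  go : Dec (i ≡ j) → Dec (j ≡ l) → Dec (l ≡ i) → χ i j l ≡ 0ℚ
  go (yes i≡j) _ _ = trans (cong (_* (δ j l * δ l i)) (δ-≡ i≡j)) (*-zeroˡ (δ j l * δ l i))
  go (no _) (yes j≡l) _ = trans (cong (λ x → δ i j * (x * δ l i)) (δ-≡ j≡l))
    (trans (cong (δ i j *_) (*-zeroˡ (δ l i))) (*-zeroʳ (δ i j)))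
  go (no _) (no _) (yes l≡i) = trans (cong (λ x → δ i j * (δ j l * x)) (δ-≡ l≡i))
    (trans (cong (δ i j *_) (*-zeroʳ (δ j l))) (*-zeroʳ (δ i j)))
  go (no i≢j) (no j≢l) (no l≢i) = ⊥-elim (¬d (i≢j , j≢l , l≢i))

module _ {A : Set} where

  ⨁ : ∀ m → (Fin m → List A) → List A
  ⨁ zero    f = []
  ⨁ (suc m) f = f zero ++ ⨁ m (f ∘ suc)

  when : ∀ {P : Set} → Dec P → List A → List A
  when (yes _) es = es
  when (no _)  es = []

  ⨁-All : ∀ {P : A → Set} m {f : Fin m → List A} → (∀ i → All P (f i)) → All P (⨁ m f)
  ⨁-All zero    h = []
  ⨁-All (suc m) h = All.++⁺ (h zero) (⨁-All m (h ∘ suc))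

  when-All : ∀ {P : A → Set} {Q : Set} (q? : Dec Q) {es} → All P es → All P (when q? es)
  when-All (yes _) h = h
  when-All (no _)  h = []

-- Both objectives have this form: `d` compares labels by `δ` for a cut, and is half the ℓ₁ distance
-- for a fractional solution.
module Total {N : ℕ} (d : Fin N → Fin N → ℚ) where

  total : List (Edge N) → ℚ
  total = foldr (λ e acc → w e * d (u e) (v e) + acc) 0ℚ

  total-++ : ∀ es fs → total (es ++ fs) ≡ total es + total fs
  total-++ []       fs = sym (+-identityˡ _)
  total-++ (e ∷ es) fs = trans (cong (w e * d (u e) (v e) +_) (total-++ es fs)) (sym (+-assoc (w e * d (u e) (v e)) _ _))

  total-⨁ : ∀ m f → total (⨁ m f) ≡ Σℚ m (total ∘ f)
  total-⨁ zero    f = refl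
  total-⨁ (suc m) f = trans (total-++ (f zero) _) (cong (total (f zero) +_) (total-⨁ m (f ∘ suc)))

  total-when-≥ : ∀ {P : Set} (p? : Dec P) {c x es} → (P → c ≡ 1ℚ) → (¬ P → c ≡ 0ℚ) →
    (P → x ≤ total es) → c * x ≤ total (when p? es)
  total-when-≥ (yes p) {x = x} c₁ c₀ h = ≤-trans (≤-reflexive (trans (cong (_* x) (c₁ p)) (*-identityˡ x))) (h p)
  total-when-≥ (no ¬p) {x = x} c₁ c₀ h = ≤-reflexive (trans (cong (_* x) (c₀ ¬p)) (*-zeroˡ x))

  total-when-≤ : ∀ {P : Set} (p? : Dec P) {c x es} → (P → c ≡ 1ℚ) → (¬ P → c ≡ 0ℚ) →
    (P → total es ≤ x) → total (when p? es) ≤ c * x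
  total-when-≤ (yes p) {x = x} c₁ c₀ h = ≤-trans (h p) (≤-reflexive (sym (trans (cong (_* x) (c₁ p)) (*-identityˡ x))))
  total-when-≤ (no ¬p) {x = x} c₁ c₀ h = ≤-reflexive (sym (trans (cong (_* x) (c₀ ¬p)) (*-zeroˡ x)))

module Gadget {V : Set} {N : ℕ} (code : V → Fin N) where

  link : ℚ → V → V → Edge N
  link c x y = edge (code x) (code y) c

  meshEdges fanEdges sideEdges rhombusEdges : ℕ → V → (ℕ → ℕ → V) → List (Edge N)
  meshEdges q t P = ⨁ q λ i → ⨁ q λ j → let a = toℕ i; b = toℕ j in
    link 1ℚ (P a b) (P a (suc b)) ∷ link 1ℚ (P a (suc b)) (P (suc a) (suc b)) ∷ link 1ℚ (P (suc a) (suc b)) (P a b) ∷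
    link 1ℚ (P a b) (P (suc a) (suc b)) ∷ link 1ℚ (P (suc a) (suc b)) (P (suc a) b) ∷ link 1ℚ (P (suc a) b) (P a b) ∷ []
  fanEdges q t P = ⨁ q λ i → let a = toℕ i in
    link 2ℚ t (P a q) ∷ link 2ℚ t (P (suc a) q) ∷ link 1ℚ (P a q) (P (suc a) q) ∷ []
  sideEdges q t P = ⨁ q λ i → let b = toℕ i in link 1ℚ (P q b) (P q (suc b)) ∷ []
  rhombusEdges q t P = meshEdges q t P ++ fanEdges q t P ++ sideEdges q t P

  pathEdges : ℚ → ℕ → (ℕ → V) → List (Edge N)
  pathEdges c m P = ⨁ m λ i → link c (P (toℕ i)) (P (suc (toℕ i))) ∷ []

  private
    0≤2 : 0ℚ ≤ 2ℚ
    0≤2 = nonNegative⁻¹ 2ℚ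

  rhombusEdges-≥0 : ∀ q t P → All (λ e → 0ℚ ≤ w e) (rhombusEdges q t P)
  rhombusEdges-≥0 q t P = All.++⁺
    (⨁-All q λ i → ⨁-All q λ j → 0≤1 ∷ 0≤1 ∷ 0≤1 ∷ 0≤1 ∷ 0≤1 ∷ 0≤1 ∷ [])
    (All.++⁺ (⨁-All q λ i → 0≤2 ∷ 0≤2 ∷ 0≤1 ∷ []) (⨁-All q λ i → 0≤1 ∷ []))

  pathEdges-≥0 : ∀ {c} → 0ℚ ≤ c → ∀ m P → All (λ e → 0ℚ ≤ w e) (pathEdges c m P)
  pathEdges-≥0 0≤c m P = ⨁-All m λ i → 0≤c ∷ []

  module _ (d : Fin N → Fin N → ℚ) where
    open Total d

    private
      D : V → V → ℚ
      D x y = d (code x) (code y)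

    total-rhombus : ∀ q t P → total (rhombusEdges q t P) ≡ rhombusCost D q t P
    total-rhombus q t P = trans
      (trans (total-++ (meshEdges q t P) _) (cong (total (meshEdges q t P) +_) (total-++ (fanEdges q t P) _)))
      (trans (sym (+-assoc (total (meshEdges q t P)) _ _))
      (cong₂ _+_ (cong₂ _+_ 
        (trans (total-⨁ q _) (Σ-cong q λ i → trans (total-⨁ q _) (Σ-cong q λ j → let a = toℕ i; b = toℕ j in
          six (D (P a b) (P a (suc b))) (D (P a (suc b)) (P (suc a) (suc b))) (D (P (suc a) (suc b)) (P a b))
              (D (P a b) (P (suc a) (suc b))) (D (P (suc a) (suc b)) (P (suc a) b)) (D (P (suc a) b) (P a b)))))
        (trans (total-⨁ q _) (Σ-cong q λ i → let a = toℕ i in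
          three (D t (P a q)) (D t (P (suc a) q)) (D (P a q) (P (suc a) q)))))
        (trans (total-⨁ q _) (Σ-cong q λ i → one (D (P q (toℕ i)) (P q (suc (toℕ i))))))))
      where
      six : ∀ a b c d e f → 1ℚ * a + (1ℚ * b + (1ℚ * c + (1ℚ * d + (1ℚ * e + (1ℚ * f + 0ℚ))))) ≡ (a + b + c) + (d + e + f)
      six = solve-∀ ℚ-ring
      three : ∀ a b c → 2ℚ * a + (2ℚ * b + (1ℚ * c + 0ℚ)) ≡ 2ℚ * a + 2ℚ * b + c
      three = solve-∀ ℚ-ring
      one : ∀ a → 1ℚ * a + 0ℚ ≡ a
      one = solve-∀ ℚ-ring

    total-path : ∀ c m P → total (pathEdges c m P) ≡ c * ∑ m (λ s → D (P s) (P (suc s)))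
    total-path c m P = trans (total-⨁ m _) (trans (Σ-cong m λ i → +-identityʳ (c * D (P (toℕ i)) (P (suc (toℕ i))))) (Σ-* m c (λ i → D (P (toℕ i)) (P (suc (toℕ i))))))

-- Used to pass from the k labels of a cut to the four roles.
rhombusCost-mono : ∀ {X Y : Set} {D : X → X → ℚ} {D′ : Y → Y → ℚ} (g : X → Y) → (∀ x y → D′ (g x) (g y) ≤ D x y) →
  ∀ q t P → rhombusCost D′ q (g t) (λ a b → g (P a b)) ≤ rhombusCost D q t P
rhombusCost-mono g h q t P = +-mono-≤ (+-mono-≤
  (Σ-mono q λ i → Σ-mono q λ j → +-mono-≤ (tri _ _ _) (tri _ _ _))
  (Σ-mono q λ i → +-mono-≤ (+-mono-≤ (*-monoˡ (nonNegative⁻¹ 2ℚ) (h _ _)) (*-monoˡ (nonNegative⁻¹ 2ℚ) (h _ _))) (h _ _)))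
  (Σ-mono q λ i → h _ _)
  where
  tri = λ x y z → +-mono-≤ (+-mono-≤ (h x y) (h y z)) (h z x)

rhombusCost≥0 : ∀ {X : Set} {D : X → X → ℚ} → (∀ x y → 0ℚ ≤ D x y) → ∀ q t P → 0ℚ ≤ rhombusCost D q t P
rhombusCost≥0 h q t P = +-mono-≤ (+-mono-≤
  (Σ≥0 q λ i → Σ≥0 q λ j → +-mono-≤ (tri _ _ _) (tri _ _ _))
  (Σ≥0 q λ i → +-mono-≤ (+-mono-≤ (*-nonneg (nonNegative⁻¹ 2ℚ) (h _ _)) (*-nonneg (nonNegative⁻¹ 2ℚ) (h _ _))) (h _ _)))
  (Σ≥0 q λ i → h _ _)
  where
  tri = λ x y z → +-mono-≤ (+-mono-≤ (h x y) (h y z)) (h z x)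

-- The roles of the labels with respect to a triple of terminals.

role : ∀ {k} → Fin k → Fin k → Fin k → Fin k → Label
role i j l x with x ≟ i | x ≟ j | x ≟ l
... | yes _ | _     | _     = 0F
... | no _  | yes _ | _     = 1F
... | no _  | no _  | yes _ = 2F
... | no _  | no _  | no _  = 3F

role-self : ∀ {k} (i j l : Fin k) → role i j l i ≡ 0F
role-self i j l with i ≟ i
... | yes _  = refl
... | no i≢i = ⊥-elim (i≢i refl)

role-rotate : ∀ {k} {i j l : Fin k} → Distinct i j l → ∀ x → role j l i x ≡ rotate (role i j l x)
role-rotate {i = i} {j} {l} (i≢j , j≢l , l≢i) x with x ≟ i | x ≟ j | x ≟ l
... | yes refl | yes refl | _        = ⊥-elim (i≢j refl)
... | yes refl | no _     | yes refl = ⊥-elim (l≢i refl)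
... | yes refl | no _     | no _     = refl
... | no _     | yes refl | _        = refl
... | no _     | no _     | yes refl = refl
... | no _     | no _     | no _     = refl

role-contracts : ∀ {k} (i j l x y : Fin k) → δ (role i j l x) (role i j l y) ≤ δ x y
role-contracts i j l x y with x ≟ y
... | yes refl = ≤-reflexive (δ-≡ {i = role i j l x} refl)
... | no _     = δ≤1 (role i j l x) (role i j l y)

-- Only an inequality, because in a degenerate triple the roles 0 and 1 take precedence over 2.
role-2 : ∀ {k} (i j l x : Fin k) → basis 2F (role i j l x) ≤ basis x l
role-2 i j l x with x ≟ i | x ≟ j | x ≟ l
... | yes _ | _     | yes _ = 0≤1
... | yes _ | _     | no _  = ≤-refl
... | no _  | yes _ | yes _ = 0≤1
... | no _  | yes _ | no _  = ≤-refl
... | no _  | no _  | yes _ = ≤-refl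
... | no _  | no _  | no _  = ≤-refl

-- Counting the labels met along a path.

module _ {k : ℕ} where

  -- The maximum of indicators counts a label once, however often the walk returns to it.
  appears : (ℕ → Fin k) → ℕ → Fin k → ℚ
  appears W zero    l = basis (W 0) l
  appears W (suc m) l = basis (W 0) l ⊔ appears (W ∘ suc) m l

  appears-≥ : ∀ W m {s} → s ℕ.≤ m → ∀ l → basis (W s) l ≤ appears W m l
  appears-≥ W zero    ℕ.z≤n       l = ≤-refl
  appears-≥ W (suc m) ℕ.z≤n       l = p≤p⊔q (basis (W 0) l) (appears (W ∘ suc) m l)
  appears-≥ W (suc m) (ℕ.s≤s s≤m) l = ≤-trans (appears-≥ (W ∘ suc) m s≤m l) (p≤q⊔p (basis (W 0) l) (appears (W ∘ suc) m l))

  basis≤1 : ∀ (i j : Fin k) → basis i j ≤ 1ℚ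
  basis≤1 i j with i ≟ j
  ... | yes _ = ≤-refl
  ... | no _  = 0≤1

  appears≤1 : ∀ W m l → appears W m l ≤ 1ℚ
  appears≤1 W zero    l = basis≤1 (W 0) l
  appears≤1 W (suc m) l = ⊔-lub (basis≤1 (W 0) l) (appears≤1 (W ∘ suc) m l)

  appears-visited : ∀ W m {s} → s ℕ.≤ m → appears W m (W s) ≡ 1ℚ
  appears-visited W m {s} s≤m = ≤-antisym (appears≤1 W m (W s))
    (≤-trans (≤-reflexive (sym (basis-refl (W s)))) (appears-≥ W m s≤m (W s)))

  -- Dropping the first vertex can lose a label only if the first step changes the label, and then
  -- it loses at most one.
  distinct-labels : ∀ W m → Σℚ k (appears W m) ≤ 1ℚ + ∑ m (λ s → δ (W s) (W (suc s)))
  distinct-labels W zero    = ≤-reflexive (Σ-basis (W 0))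
  distinct-labels W (suc m) = ≤-trans (Σ-mono k new)
    (≤-trans (≤-reflexive (trans (Σ-+ k (λ l → δ (W 0) (W 1) * basis (W 0) l) (appears (W ∘ suc) m))
        (cong (_+ Σℚ k (appears (W ∘ suc) m)) (trans (Σ-* k (δ (W 0) (W 1)) (basis (W 0)))
          (trans (cong (δ (W 0) (W 1) *_) (Σ-basis (W 0))) (*-identityʳ (δ (W 0) (W 1))))))))
      (≤-trans (+-monoʳ-≤ (δ (W 0) (W 1)) (distinct-labels (W ∘ suc) m))
        (≤-reflexive (lem (δ (W 0) (W 1)) (∑ m (λ s → δ (W (suc s)) (W (suc (suc s)))))))))
    where
    lem : ∀ x y → x + (1ℚ + y) ≡ 1ℚ + (x + y)
    lem = solve-∀ ℚ-ring
    appears≥0 : ∀ l → 0ℚ ≤ appears (W ∘ suc) m l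
    appears≥0 l = ≤-trans (basis-≥0 (W 1) l) (appears-≥ (W ∘ suc) m ℕ.z≤n l)
    new : ∀ l → basis (W 0) l ⊔ appears (W ∘ suc) m l ≤ δ (W 0) (W 1) * basis (W 0) l + appears (W ∘ suc) m l
    new l = case (W 0 ≟ W 1)
      where
      case : Dec (W 0 ≡ W 1) → basis (W 0) l ⊔ appears (W ∘ suc) m l ≤ δ (W 0) (W 1) * basis (W 0) l + appears (W ∘ suc) m l
      case (yes W₀≡W₁) = ≤-trans (⊔-lub (subst (λ x → basis x l ≤ appears (W ∘ suc) m l) (sym W₀≡W₁) (appears-≥ (W ∘ suc) m ℕ.z≤n l)) ≤-refl)
        (≤-reflexive (sym (trans (cong (λ x → x * basis (W 0) l + appears (W ∘ suc) m l) (δ-≡ W₀≡W₁))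
          (trans (cong (_+ appears (W ∘ suc) m l) (*-zeroˡ (basis (W 0) l))) (+-identityˡ (appears (W ∘ suc) m l))))))
      case (no W₀≢W₁) = ≤-trans (⊔-lub
          (≤-trans (≤-reflexive (sym (+-identityʳ (basis (W 0) l)))) (+-monoʳ-≤ (basis (W 0) l) (appears≥0 l)))
          (≤-trans (≤-reflexive (sym (+-identityˡ (appears (W ∘ suc) m l)))) (+-monoˡ-≤ (appears (W ∘ suc) m l) (basis-≥0 (W 0) l))))
        (≤-reflexive (sym (trans (cong (λ x → x * basis (W 0) l + appears (W ∘ suc) m l) (δ-≢ W₀≢W₁))
          (cong (_+ appears (W ∘ suc) m l) (*-identityˡ (basis (W 0) l))))))

-- The instance

Finite : Set → Set
Finite A = ∃ λ n → A ↔ Fin n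

fin : ∀ {n} → Finite (Fin n)
fin {n} = n , ↔-refl

_⊎-fin_ : ∀ {A B} → Finite A → Finite B → Finite (A ⊎ B)
(m , f) ⊎-fin (n , g) = m ℕ.+ n , ↔-trans (f ⊎-↔ g) (↔-sym +↔⊎)

_×-fin_ : ∀ {A B} → Finite A → Finite B → Finite (A × B)
(m , f) ×-fin (n , g) = m ℕ.* n , ↔-trans (f ×-↔ g) (↔-sym *↔×)

infixr 2 _×-fin_
infixr 1 _⊎-fin_

-- Sums over pairs and triples of terminals.

module _ (k : ℕ) where

  Σ² : (Fin k → Fin k → ℚ) → ℚ
  Σ² f = Σℚ k λ i → Σℚ k λ j → f i j

  Σ³ : (Fin k → Fin k → Fin k → ℚ) → ℚ
  Σ³ f = Σℚ k λ i → Σ² (f i)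

  Σ²-cong : ∀ {f g : Fin k → Fin k → ℚ} → (∀ i j → f i j ≡ g i j) → Σ² f ≡ Σ² g
  Σ²-cong h = Σ-cong k λ i → Σ-cong k (h i)

  Σ³-cong : ∀ {f g : Fin k → Fin k → Fin k → ℚ} → (∀ i j l → f i j l ≡ g i j l) → Σ³ f ≡ Σ³ g
  Σ³-cong h = Σ-cong k λ i → Σ²-cong (h i)

  Σ²-mono : ∀ {f g : Fin k → Fin k → ℚ} → (∀ i j → f i j ≤ g i j) → Σ² f ≤ Σ² g
  Σ²-mono h = Σ-mono k λ i → Σ-mono k (h i)

  Σ³-mono : ∀ {f g : Fin k → Fin k → Fin k → ℚ} → (∀ i j l → f i j l ≤ g i j l) → Σ³ f ≤ Σ³ g
  Σ³-mono h = Σ-mono k λ i → Σ²-mono (h i)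

  Σ²-* : ∀ c f → Σ² (λ i j → c * f i j) ≡ c * Σ² f
  Σ²-* c f = trans (Σ-cong k λ i → Σ-* k c (f i)) (Σ-* k c (λ i → Σℚ k (f i)))

  Σ²-+ : ∀ f g → Σ² (λ i j → f i j + g i j) ≡ Σ² f + Σ² g
  Σ²-+ f g = trans (Σ-cong k λ i → Σ-+ k (f i) (g i)) (Σ-+ k (λ i → Σℚ k (f i)) (λ i → Σℚ k (g i)))

  Σ³-* : ∀ c f → Σ³ (λ i j l → c * f i j l) ≡ c * Σ³ f
  Σ³-* c f = trans (Σ-cong k λ i → Σ²-* c (f i)) (Σ-* k c (λ i → Σ² (f i)))

  Σ³-+ : ∀ f g → Σ³ (λ i j l → f i j l + g i j l) ≡ Σ³ f + Σ³ g
  Σ³-+ f g = trans (Σ-cong k λ i → Σ²-+ (f i) (g i)) (Σ-+ k (λ i → Σ² (f i)) (λ i → Σ² (g i)))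

  Σ³-rotate : ∀ f → Σ³ (λ i j l → f j l i) ≡ Σ³ f
  Σ³-rotate f = trans (Σ-swap k k (λ i j → Σℚ k λ l → f j l i)) (Σ-cong k λ j → Σ-swap k k (λ i l → f j l i))

  pairs : Σ² δ ≡ ι k * (ι k - 1ℚ)
  pairs = trans (Σ-cong k λ i → trans (Σ-- k (λ _ → 1ℚ) (basis i)) (cong₂ _-_ (trans (Σ-const k 1ℚ) (*-identityʳ (ι k))) (Σ-basis i)))
    (Σ-const k (ι k - 1ℚ))

  basis-sym : ∀ (i j : Fin k) → basis i j ≡ basis j i
  basis-sym i j = go (i ≟ j)
    where
    go : Dec (i ≡ j) → basis i j ≡ basis j i
    go (yes i≡j) = cong₂ basis i≡j (sym i≡j)
    go (no i≢j)  = trans (basis-≢ i≢j) (sym (basis-≢ (i≢j ∘ sym)))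

  -- Inclusion-exclusion over l: the values j and i are excluded, and for i ≢ j they do not overlap.
  Σχ : ∀ i j → Σℚ k (χ i j) ≡ δ i j * (ι k - 2ℚ)
  Σχ i j = trans (Σ-* k (δ i j) (λ l → δ j l * δ l i)) (go (i ≟ j))
    where
    expand : ∀ a b → (1ℚ - a) * (1ℚ - b) ≡ (1ℚ - a - b) + a * b
    expand = solve-∀ ℚ-ring
    lem : ∀ n → (n * 1ℚ - 1ℚ - 1ℚ) + 0ℚ ≡ n - 2ℚ
    lem = solve-∀ ℚ-ring
    inner : i ≢ j → Σℚ k (λ l → δ j l * δ l i) ≡ ι k - 2ℚ
    inner i≢j = trans (Σ-cong k λ l → trans (cong (λ x → δ j l * (1ℚ - x)) (basis-sym l i)) (expand (basis j l) (basis i l)))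
      (trans (Σ-+ k (λ l → 1ℚ - basis j l - basis i l) (λ l → basis j l * basis i l))
      (trans (cong₂ _+_ (trans (Σ-- k (λ l → 1ℚ - basis j l) (basis i))
          (cong₂ _-_ (trans (Σ-- k (λ _ → 1ℚ) (basis j)) (cong₂ _-_ (Σ-const k 1ℚ) (Σ-basis j))) (Σ-basis i)))
        (trans (Σ-basis-* j (basis i)) (basis-≢ i≢j)))
      (lem (ι k))))
    go : Dec (i ≡ j) → δ i j * Σℚ k (λ l → δ j l * δ l i) ≡ δ i j * (ι k - 2ℚ)
    go (no i≢j)  = cong (δ i j *_) (inner i≢j)
    go (yes i≡j) = trans (cong (_* Σℚ k (λ l → δ j l * δ l i)) (δ-≡ i≡j)) (trans (*-zeroˡ (Σℚ k (λ l → δ j l * δ l i)))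
      (sym (trans (cong (_* (ι k - 2ℚ)) (δ-≡ i≡j)) (*-zeroˡ (ι k - 2ℚ)))))

  triples : Σ³ χ ≡ ι k * (ι k - 1ℚ) * (ι k - 2ℚ)
  triples = trans (Σ²-cong Σχ) (trans (Σ²-cong λ i j → *-comm (δ i j) (ι k - 2ℚ))
    (trans (Σ²-* (ι k - 2ℚ) δ) (trans (cong ((ι k - 2ℚ) *_) pairs) (*-comm (ι k - 2ℚ) _))))

module Construction (k p : ℕ) where

  q : ℕ
  q = suc p

  -- A side point names no third terminal, so all hexagons on an ordered pair share it. Centers and
  -- inner points belong to one ordered triple: the rotations of a triple give three hexagons with
  -- the same sides. Tuples that occur in no edge are isolated vertices and cost nothing.
  Vertex : Set
  Vertex = Fin k ⊎ (Fin k × Fin k × Fin (suc q)) ⊎ (Fin k × Fin k × Fin k) ⊎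
    (Fin k × Fin k × Fin k × Fin 3 × Fin (suc q) × Fin (suc q))

  pattern term i             = inj₁ i
  pattern side i j s         = inj₂ (inj₁ (i , j , s))
  pattern center i j l       = inj₂ (inj₂ (inj₁ (i , j , l)))
  pattern inner i j l r a b  = inj₂ (inj₂ (inj₂ (i , j , l , r , a , b)))

  vertices : Finite Vertex
  vertices = fin ⊎-fin (fin ×-fin fin ×-fin fin) ⊎-fin (fin ×-fin fin ×-fin fin) ⊎-fin
    (fin ×-fin fin ×-fin fin ×-fin fin ×-fin fin ×-fin fin)

  previous : Fin 3 → Fin 3
  previous 0F = 2F
  previous 1F = 0F
  previous 2F = 1F

  -- Only meaningful for s ≤ q.
  index : ℕ → Fin (suc q)
  index s = s mod suc q

  toℕ-index : ∀ {s} → s ℕ.≤ q → toℕ (index s) ≡ s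
  toℕ-index s≤q = trans (toℕ-fromℕ< _) (m<n⇒m%n≡m (ℕ.s≤s s≤q))

  module Hexagon (i j l : Fin k) where

    corner next opposite : Fin 3 → Fin k
    corner 0F = i
    corner 1F = j
    corner 2F = l
    next 0F = j
    next 1F = l
    next 2F = i
    opposite 0F = l
    opposite 1F = i
    opposite 2F = j

    off-axis : ∀ {a} → Dec (a ≡ q) → Fin 3 → ℕ → Vertex
    off-axis     (yes _) r b = side (corner r) (next r) (index b)
    off-axis {a} (no _)  r b = inner i j l r (index a) (index b)

    -- The axis a = 0 of a rhombus is the axis b = 0 of the previous one, and the side a = q is shared with
    -- the other hexagons that have this ordered pair of corners.
    pt : Fin 3 → ℕ → ℕ → Vertex
    pt r zero    zero    = center i j l
    pt r zero    (suc b) = off-axis (suc b ℕ.≟ q) (previous r) zero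
    pt r (suc a) b       = off-axis (suc a ℕ.≟ q) r b

    pt-glue : ∀ r b → pt r 0 b ≡ pt (previous r) b 0
    pt-glue r zero    = refl
    pt-glue r (suc b) = refl

    pt-side : ∀ r b → pt r q b ≡ side (corner r) (next r) (index b)
    pt-side r b with p ℕ.≟ p | q ℕ.≟ q
    ... | _ | yes _   = refl
    ... | _ | no q≢q = ⊥-elim (q≢q refl)

  open Hexagon using (pt)

  stop : ∀ {b} → Dec (b ℕ.≤ q) → Fin k → Fin k → Vertex
  stop {b} (yes _) i j = side i j (index b)
  stop     (no _)  i j = term i

  -- Starts at terminal j because the i-th coordinate of the side points grows with their index.
  path : Fin k → Fin k → ℕ → Vertex
  path i j zero    = term j
  path i j (suc b) = stop (b ℕ.≤? q) i j

  path-side : ∀ i j {b} → b ℕ.≤ q → path i j (suc b) ≡ side i j (index b)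
  path-side i j {b} b≤q with b ℕ.≤? q
  ... | yes _   = refl
  ... | no b≰q = ⊥-elim (b≰q b≤q)

  pathLength : ℕ
  -- The `q` steps along the side and one step to a terminal at each end.
  pathLength = suc (suc q)

  path-end : ∀ i j → path i j pathLength ≡ term i
  path-end i j with suc q ℕ.≤? q
  ... | yes q<q = ⊥-elim (ℕₚ.<-irrefl refl q<q)
  ... | no _    = refl

  unit : ℚ
  unit = 4ℚ * ι q

  pathWeight : ℚ
  pathWeight = unit * (1ℚ + 2ℚ)

  0≤unit : 0ℚ ≤ unit
  0≤unit = *-nonneg (nonNegative⁻¹ 4ℚ) (ι≥0 q)

  0≤pathWeight : 0ℚ ≤ pathWeight
  0≤pathWeight = *-nonneg 0≤unit (nonNegative⁻¹ (1ℚ + 2ℚ))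

  size : ℕ
  size = proj₁ vertices

  code : Vertex → Fin size
  code = Inverse.to (proj₂ vertices)

  decode : Fin size → Vertex
  decode = Inverse.from (proj₂ vertices)

  decode-code : ∀ x → decode (code x) ≡ x
  decode-code = Inverse.strictlyInverseʳ (proj₂ vertices)

  open Gadget code

  hexagonEdges : (i j l : Fin k) → List (Edge size)
  hexagonEdges i j l = rhombusEdges q (term i) (pt i j l 0F) ++ rhombusEdges q (term j) (pt i j l 1F)
    ++ rhombusEdges q (term l) (pt i j l 2F)

  allHexagons allPaths : List (Edge size)
  allHexagons = ⨁ k λ i → ⨁ k λ j → ⨁ k λ l → when (distinct? i j l) (hexagonEdges i j l)
  allPaths    = ⨁ k λ i → ⨁ k λ j → when (¬? (i ≟ j)) (pathEdges pathWeight pathLength (path i j))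

  hexagonEdges-≥0 : ∀ i j l → All (λ e → 0ℚ ≤ w e) (hexagonEdges i j l)
  hexagonEdges-≥0 i j l = All.++⁺ (rhombusEdges-≥0 q (term i) (pt i j l 0F))
    (All.++⁺ (rhombusEdges-≥0 q (term j) (pt i j l 1F)) (rhombusEdges-≥0 q (term l) (pt i j l 2F)))

  allHexagons-≥0 : All (λ e → 0ℚ ≤ w e) allHexagons
  allHexagons-≥0 = ⨁-All k λ i → ⨁-All k λ j → ⨁-All k λ l → when-All (distinct? i j l) (hexagonEdges-≥0 i j l)

  allPaths-≥0 : All (λ e → 0ℚ ≤ w e) allPaths
  allPaths-≥0 = ⨁-All k λ i → ⨁-All k λ j → when-All (¬? (i ≟ j)) (pathEdges-≥0 0≤pathWeight pathLength (path i j))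

  term-injective : ∀ {i j : Fin k} → code (term i) ≡ code (term j) → i ≡ j
  term-injective {i} {j} e = inj₁-injective (trans (sym (decode-code (term i))) (trans (cong decode e) (decode-code (term j))))

  gapInstance : Instance k
  gapInstance = record
    { n = size
    ; edges = allHexagons ++ allPaths
    ; weights≥0 = All.++⁺ allHexagons-≥0 allPaths-≥0
    ; terminal = λ i → code (term i)
    ; terminals-distinct = term-injective
    }

  hexagonCost : (Vertex → Vertex → ℚ) → Fin k → Fin k → Fin k → ℚ
  hexagonCost D i j l = rhombusCost D q (term i) (pt i j l 0F) + rhombusCost D q (term j) (pt i j l 1F)
    + rhombusCost D q (term l) (pt i j l 2F)

  pathCost : (Vertex → Vertex → ℚ) → Fin k → Fin k → ℚ
  pathCost D i j = ∑ pathLength λ s → D (path i j s) (path i j (suc s))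

  module _ (d : Fin size → Fin size → ℚ) where
    open Total d

    private
      D : Vertex → Vertex → ℚ
      D x y = d (code x) (code y)

      total-hexagon : ∀ i j l → total (hexagonEdges i j l) ≡ hexagonCost D i j l
      total-hexagon i j l = trans (total-++ (rhombusEdges q (term i) (pt i j l 0F)) _) (trans
        (cong₂ _+_ (total-rhombus d q (term i) (pt i j l 0F)) (trans (total-++ (rhombusEdges q (term j) (pt i j l 1F)) _)
          (cong₂ _+_ (total-rhombus d q (term j) (pt i j l 1F)) (total-rhombus d q (term l) (pt i j l 2F)))))
        (sym (+-assoc (rhombusCost D q (term i) (pt i j l 0F)) _ _)))

      total-split : total (allHexagons ++ allPaths) ≡
        Σ³ k (λ i j l → total (when (distinct? i j l) (hexagonEdges i j l)))
        + Σ² k (λ i j → total (when (¬? (i ≟ j)) (pathEdges pathWeight pathLength (path i j))))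
      total-split = trans (total-++ allHexagons allPaths) (cong₂ _+_
        (trans (total-⨁ k _) (Σ-cong k λ i → trans (total-⨁ k _) (Σ-cong k λ j → total-⨁ k _)))
        (trans (total-⨁ k _) (Σ-cong k λ i → total-⨁ k _)))

    total-≥ : ∀ {H : Fin k → Fin k → Fin k → ℚ} {P : Fin k → Fin k → ℚ} → (∀ {i j l} → Distinct i j l → H i j l ≤ hexagonCost D i j l) → (∀ {i j} → i ≢ j → P i j ≤ pathCost D i j) →
      Σ³ k (λ i j l → χ i j l * H i j l) + Σ² k (λ i j → δ i j * (pathWeight * P i j)) ≤ total (allHexagons ++ allPaths)
    total-≥ {H} {P} hexagons paths = ≤-trans (+-mono-≤
      (Σ³-mono k λ i j l → total-when-≥ (distinct? i j l) {x = H i j l} {es = hexagonEdges i j l} χ-distinct χ-degenerate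
        (λ ijl → ≤-trans (hexagons ijl) (≤-reflexive (sym (total-hexagon i j l)))))
      (Σ²-mono k λ i j → total-when-≥ (¬? (i ≟ j)) {x = pathWeight * P i j} {es = pathEdges pathWeight pathLength (path i j)} δ-≢ (λ ¬¬e → δ-≡ (decidable-stable (i ≟ j) ¬¬e))
        (λ i≢j → ≤-trans (*-monoˡ 0≤pathWeight (paths i≢j)) (≤-reflexive (sym (total-path d pathWeight pathLength (path i j)))))))
      (≤-reflexive (sym total-split))

    total-≤ : ∀ {H : Fin k → Fin k → Fin k → ℚ} {P : Fin k → Fin k → ℚ} → (∀ {i j l} → Distinct i j l → hexagonCost D i j l ≤ H i j l) → (∀ {i j} → i ≢ j → pathCost D i j ≤ P i j) →
      total (allHexagons ++ allPaths) ≤ Σ³ k (λ i j l → χ i j l * H i j l) + Σ² k (λ i j → δ i j * (pathWeight * P i j))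
    total-≤ {H} {P} hexagons paths = ≤-trans (≤-reflexive total-split) (+-mono-≤
      (Σ³-mono k λ i j l → total-when-≤ (distinct? i j l) {x = H i j l} {es = hexagonEdges i j l} χ-distinct χ-degenerate
        (λ ijl → ≤-trans (≤-reflexive (total-hexagon i j l)) (hexagons ijl)))
      (Σ²-mono k λ i j → total-when-≤ (¬? (i ≟ j)) {x = pathWeight * P i j} {es = pathEdges pathWeight pathLength (path i j)} δ-≢ (λ ¬¬e → δ-≡ (decidable-stable (i ≟ j) ¬¬e))
        (λ i≢j → ≤-trans (≤-reflexive (total-path d pathWeight pathLength (path i j))) (*-monoˡ 0≤pathWeight (paths i≢j)))))

-- Multiway cuts of the instance

module _ (k p : ℕ) where
  open Construction k p
  open Hexagon using (pt; pt-glue; pt-side; corner; next; opposite)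

  module _ (σ : Fin size → Fin k) (f-term : ∀ i → σ (code (term i)) ≡ i) where

    private
      f : Vertex → Fin k
      f = σ ∘ code

      D : Vertex → Vertex → ℚ
      D x y = δ (f x) (f y)

      visits : Fin k → Fin k → Fin k → ℚ
      visits i j = appears (f ∘ path i j) pathLength

      unvisited : Fin k → Fin k → Fin k → ℚ
      unvisited i j l = 1ℚ - visits i j l

      visits-start : ∀ i j → visits i j j ≡ 1ℚ
      visits-start i j = trans (cong (visits i j) (sym (f-term j))) (appears-visited (f ∘ path i j) pathLength ℕ.z≤n)

      visits-end : ∀ i j → visits i j i ≡ 1ℚ
      visits-end i j = trans (cong (visits i j) (sym (trans (cong f (path-end i j)) (f-term i))))
        (appears-visited (f ∘ path i j) pathLength ℕₚ.≤-refl)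

      -- The path contains both its terminals, so l = i and l = j are never unvisited. Without the
      -- conditions on l in the indicator, the sum over l simply counts the labels missing from the
      -- path.
      χ-unvisited : ∀ i j l → χ i j l * unvisited i j l ≡ δ i j * unvisited i j l
      χ-unvisited i j l = trans (*-assoc (δ i j) (δ j l * δ l i) (unvisited i j l)) (cong (δ i j *_) (go (j ≟ l) (l ≟ i)))
        where
        vanish : unvisited i j l ≡ 0ℚ → δ j l * δ l i * unvisited i j l ≡ unvisited i j l
        vanish e = trans (cong (δ j l * δ l i *_) e) (trans (*-zeroʳ (δ j l * δ l i)) (sym e))
        go : Dec (j ≡ l) → Dec (l ≡ i) → δ j l * δ l i * unvisited i j l ≡ unvisited i j l
        go (yes j≡l) _ = vanish (cong (λ x → 1ℚ - x) (trans (cong (visits i j) (sym j≡l)) (visits-start i j)))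
        go (no _) (yes l≡i) = vanish (cong (λ x → 1ℚ - x) (trans (cong (visits i j) l≡i) (visits-end i j)))
        go (no j≢l) (no l≢i) = trans (cong₂ (λ x y → x * y * unvisited i j l) (δ-≢ j≢l) (δ-≢ l≢i))
          (*-identityˡ (unvisited i j l))

      module _ {i j l : Fin k} (ijl : Distinct i j l) where

        labels : Fin 3 → ℕ → ℕ → Label
        labels r a b = role (corner i j l r) (next i j l r) (opposite i j l r) (f (pt i j l r a b))

        distinct : ∀ r → Distinct (corner i j l r) (next i j l r) (opposite i j l r)
        distinct 0F = ijl
        distinct 1F = let (a , b , c) = ijl in b , c , a
        distinct 2F = let (a , b , c) = ijl in c , a , b

        glue : ∀ r (r′ : Fin 3) → previous r ≡ r′ → (∀ x → role (corner i j l r) (next i j l r) (opposite i j l r) x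
          ≡ rotate (role (corner i j l r′) (next i j l r′) (opposite i j l r′) x)) → ∀ b → labels r 0 b ≡ rotate (labels r′ b 0)
        glue r r′ refl turn b = trans (cong (role (corner i j l r) (next i j l r) (opposite i j l r) ∘ f) (pt-glue i j l r b))
          (turn (f (pt i j l r′ b 0)))

        foreign : ∀ r b → b ℕ.≤ q → basis 2F (labels r q b) ≤ visits (corner i j l r) (next i j l r) (opposite i j l r)
        foreign r b b≤q = ≤-trans (role-2 (corner i j l r) (next i j l r) (opposite i j l r) (f (pt i j l r q b)))
          (≤-trans (≤-reflexive (cong (λ x → basis (f x) (opposite i j l r))
              (trans (pt-side i j l r b) (sym (path-side (corner i j l r) (next i j l r) b≤q)))))
            -- The path begins with a terminal, so the side point `b` is its vertex `suc b`.
            (appears-≥ (f ∘ path (corner i j l r) (next i j l r)) pathLength (ℕ.s≤s (ℕₚ.m≤n⇒m≤1+n b≤q)) (opposite i j l r)))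

        rhombus≥ : ∀ r → rhombusCost δ q 0F (labels r) ≤ rhombusCost D q (term (corner i j l r)) (pt i j l r)
        rhombus≥ r = subst (λ t → rhombusCost δ q t (labels r) ≤ rhombusCost D q (term (corner i j l r)) (pt i j l r))
          (trans (cong (role (corner i j l r) (next i j l r) (opposite i j l r)) (f-term (corner i j l r)))
                 (role-self (corner i j l r) (next i j l r) (opposite i j l r)))
          (rhombusCost-mono {D = D} {D′ = δ} (role (corner i j l r) (next i j l r) (opposite i j l r) ∘ f)
            (λ x y → role-contracts (corner i j l r) (next i j l r) (opposite i j l r) (f x) (f y)) q (term (corner i j l r)) (pt i j l r))

        hexagon≥ : unit * (unvisited i j l + unvisited j l i + unvisited l i j) ≤ hexagonCost D i j l
        hexagon≥ = ≤-trans
          (hexagon-bound q (labels 0F) (labels 1F) (labels 2F)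
            (glue 1F 0F refl (role-rotate (distinct 0F))) (glue 2F 1F refl (role-rotate (distinct 1F)))
            (glue 0F 2F refl (role-rotate (distinct 2F)))
            (foreign 0F) (foreign 1F) (foreign 2F))
          (+-mono-≤ (+-mono-≤ (rhombus≥ 0F) (rhombus≥ 1F)) (rhombus≥ 2F))

      path≥ : ∀ i j → Σℚ k (visits i j) - 1ℚ ≤ pathCost D i j
      path≥ i j = ≤-trans (+-monoˡ-≤ (- 1ℚ) (distinct-labels (f ∘ path i j) pathLength))
        (≤-reflexive (lem (pathCost D i j)))
        where
        lem : ∀ x → 1ℚ + x - 1ℚ ≡ x
        lem = solve-∀ ℚ-ring

      hexagons : Fin k → Fin k → Fin k → ℚ
      hexagons i j l = unit * (unvisited i j l + unvisited j l i + unvisited l i j)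

      χ-rotate : ∀ i j l → χ i j l ≡ χ {k} j l i
      χ-rotate i j l = lem (δ i j) (δ j l) (δ l i)
        where
        lem : ∀ a b c → a * (b * c) ≡ b * (c * a)
        lem = solve-∀ ℚ-ring

      free : Fin k → Fin k → Fin k → ℚ
      free i j l = χ i j l * unvisited i j l

      sum-free : Σ³ k free ≡ Σ² k (λ i j → δ i j * (ι k - Σℚ k (visits i j)))
      sum-free = Σ²-cong k λ i j → trans (Σ-cong k (χ-unvisited i j)) (trans (Σ-* k (δ i j) (unvisited i j))
        (cong (δ i j *_) (trans (Σ-- k (λ _ → 1ℚ) (visits i j))
          (cong (λ x → x - Σℚ k (visits i j)) (trans (Σ-const k 1ℚ) (*-identityʳ (ι k)))))))

      -- A sum over all ordered triples does not change under rotation, so the three terms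
      -- contribute equally. This is why `pathWeight` is three times `unit`.
      sum-hexagons : Σ³ k (λ i j l → χ i j l * hexagons i j l) ≡ pathWeight * Σ³ k free
      sum-hexagons = trans (Σ³-cong k λ i j l → trans
          (distribute (χ i j l) unit (unvisited i j l) (unvisited j l i) (unvisited l i j))
          (cong₂ (λ x y → unit * (free i j l + x * unvisited j l i + y * unvisited l i j)) (χ-rotate i j l)
            (trans (χ-rotate i j l) (χ-rotate j l i))))
        (trans (Σ³-* k unit (λ i j l → free i j l + free j l i + free l i j))
        (trans (cong (unit *_) (trans (Σ³-+ k (λ i j l → free i j l + free j l i) (λ i j l → free l i j))
          (cong₂ _+_ (trans (Σ³-+ k free (λ i j l → free j l i)) (cong (Σ³ k free +_) (Σ³-rotate k free)))
            (trans (Σ³-rotate k (λ i j l → free j l i)) (Σ³-rotate k free)))))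
          (triple unit (Σ³ k free))))
        where
        distribute : ∀ c u x y z → c * (u * (x + y + z)) ≡ u * (c * x + c * y + c * z)
        distribute = solve-∀ ℚ-ring
        triple : ∀ u s → u * (s + s + s) ≡ u * (1ℚ + 2ℚ) * s
        triple = solve-∀ ℚ-ring

    -- If the path of an ordered pair meets S labels, then, in units of `pathWeight`, the hexagons
    -- contribute k - S for this pair and the path contributes S - 1. S cancels and k - 1 is left
    -- for each of the k (k - 1) pairs.
    cut-bound : pathWeight * (ι k * (ι k - 1ℚ) * (ι k - 1ℚ)) ≤ Total.total (λ x y → δ (σ x) (σ y)) (allHexagons ++ allPaths)
    cut-bound = ≤-trans (≤-reflexive (sym sums))
      (total-≥ (λ x y → δ (σ x) (σ y)) {hexagons} {λ i j → Σℚ k (visits i j) - 1ℚ} hexagon≥ (λ {i} {j} _ → path≥ i j))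
      where
      open ≡-Reasoning
      missing excess : Fin k → Fin k → ℚ
      missing i j = δ i j * (ι k - Σℚ k (visits i j))
      excess  i j = δ i j * (Σℚ k (visits i j) - 1ℚ)
      swap : ∀ a b c → a * (b * c) ≡ b * (a * c)
      swap = solve-∀ ℚ-ring
      merge : ∀ d n s → d * (n - s) + d * (s - 1ℚ) ≡ (n - 1ℚ) * d
      merge = solve-∀ ℚ-ring
      sums : Σ³ k (λ i j l → χ i j l * hexagons i j l) + Σ² k (λ i j → δ i j * (pathWeight * (Σℚ k (visits i j) - 1ℚ)))
        ≡ pathWeight * (ι k * (ι k - 1ℚ) * (ι k - 1ℚ))
      sums = begin
        Σ³ k (λ i j l → χ i j l * hexagons i j l) + Σ² k (λ i j → δ i j * (pathWeight * (Σℚ k (visits i j) - 1ℚ)))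
          ≡⟨ cong₂ _+_ (trans sum-hexagons (cong (pathWeight *_) sum-free))
               (trans (Σ²-cong k λ i j → swap (δ i j) pathWeight (Σℚ k (visits i j) - 1ℚ)) (Σ²-* k pathWeight excess)) ⟩
        pathWeight * Σ² k missing + pathWeight * Σ² k excess
          ≡⟨ sym (*-distribˡ-+ pathWeight (Σ² k missing) (Σ² k excess)) ⟩
        pathWeight * (Σ² k missing + Σ² k excess)
          ≡⟨ cong (pathWeight *_) (sym (Σ²-+ k missing excess)) ⟩
        pathWeight * Σ² k (λ i j → missing i j + excess i j)
          ≡⟨ cong (pathWeight *_) (trans (Σ²-cong k λ i j → merge (δ i j) (ι k) (Σℚ k (visits i j))) (Σ²-* k (ι k - 1ℚ) δ)) ⟩
        pathWeight * ((ι k - 1ℚ) * Σ² k δ)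
          ≡⟨ cong (pathWeight *_) (trans (cong ((ι k - 1ℚ) *_) (pairs k)) (*-comm (ι k - 1ℚ) (ι k * (ι k - 1ℚ)))) ⟩
        pathWeight * (ι k * (ι k - 1ℚ) * (ι k - 1ℚ)) ∎

-- The fractional solution

ι-mono : ∀ {m n} → m ℕ.≤ n → ι m ≤ ι n
ι-mono {n = n} ℕ.z≤n = ι≥0 n
ι-mono (ℕ.s≤s m≤n)   = +-monoʳ-≤ 1ℚ (ι-mono m≤n)

-- Distances between points of the simplex.

module _ {k : ℕ} where

  combo : ℚ → ℚ → ℚ → Fin k → Fin k → Fin k → Fin k → ℚ
  combo α β γ i j l c = α * basis i c + β * basis j c + γ * basis l c

  combo≥0 : ∀ {α β γ} → 0ℚ ≤ α → 0ℚ ≤ β → 0ℚ ≤ γ → ∀ i j l c → 0ℚ ≤ combo α β γ i j l c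
  combo≥0 α≥0 β≥0 γ≥0 i j l c = +-mono-≤ (+-mono-≤ (*-nonneg α≥0 (basis-≥0 i c)) (*-nonneg β≥0 (basis-≥0 j c)))
    (*-nonneg γ≥0 (basis-≥0 l c))

  Σ-combo : ∀ α β γ i j l → Σℚ k (combo α β γ i j l) ≡ α + β + γ
  Σ-combo α β γ i j l = trans (Σ-+ k (λ c → α * basis i c + β * basis j c) (λ c → γ * basis l c))
    (cong₂ _+_ (trans (Σ-+ k (λ c → α * basis i c) (λ c → β * basis j c)) (cong₂ _+_ (weight α i) (weight β j))) (weight γ l))
    where
    weight : ∀ α i → Σℚ k (λ c → α * basis i c) ≡ α
    weight α i = trans (Σ-* k α (basis i)) (trans (cong (α *_) (Σ-basis i)) (*-identityʳ α))

  dist : (Fin k → ℚ) → (Fin k → ℚ) → ℚ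
  dist x y = ½ * Σℚ k (λ c → ∣ x c - y c ∣)

  dist≥0 : ∀ x y → 0ℚ ≤ dist x y
  dist≥0 x y = *-nonneg (nonNegative⁻¹ ½) (Σ≥0 k λ c → 0≤∣p∣ (x c - y c))

  dist-coordinate : ∀ x y i → ½ * (y i - x i) ≤ dist x y
  dist-coordinate x y i = *-monoˡ (nonNegative⁻¹ ½) (≤-trans (signed (x i) (y i))
    (≤-trans (≤-reflexive (sym (Σ-basis-* i (λ c → ∣ x c - y c ∣)))) (Σ-mono k single)))
    where
    single : ∀ c → basis i c * ∣ x c - y c ∣ ≤ ∣ x c - y c ∣
    single c with i ≟ c
    ... | yes _ = ≤-reflexive (*-identityˡ ∣ x c - y c ∣)
    ... | no _  = ≤-trans (≤-reflexive (*-zeroˡ ∣ x c - y c ∣)) (0≤∣p∣ (x c - y c))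
    neg-diff : ∀ a b → - (a - b) ≡ b - a
    neg-diff = solve-∀ ℚ-ring
    signed : ∀ a b → b - a ≤ ∣ a - b ∣
    signed a b = ≤-trans (p≤∣p∣ (b - a)) (≤-reflexive (trans (cong ∣_∣ (sym (neg-diff a b))) (∣-p∣≡∣p∣ (a - b))))

  -- An inequality, since the three indices may coincide, as they do for the points of a path.
  dist-combo : ∀ {x y α β γ α′ β′ γ′ i j l} → (∀ c → x c ≡ combo α β γ i j l c) → (∀ c → y c ≡ combo α′ β′ γ′ i j l c) →
    dist x y ≤ ½ * (∣ α - α′ ∣ + ∣ β - β′ ∣ + ∣ γ - γ′ ∣)
  dist-combo {x} {y} {α} {β} {γ} {α′} {β′} {γ′} {i} {j} {l} hx hy = *-monoˡ (nonNegative⁻¹ ½)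
    (≤-trans (Σ-mono k termwise) (≤-reflexive (Σ-combo (∣ α - α′ ∣) (∣ β - β′ ∣) (∣ γ - γ′ ∣) i j l)))
    where
    lem : ∀ a b g a′ b′ g′ x y z → (a * x + b * y + g * z) - (a′ * x + b′ * y + g′ * z)
      ≡ (a - a′) * x + (b - b′) * y + (g - g′) * z
    lem = solve-∀ ℚ-ring
    abs-basis : ∀ p i c → ∣ p * basis i c ∣ ≡ ∣ p ∣ * basis i c
    abs-basis p i c = trans (∣p*q∣≡∣p∣*∣q∣ p (basis i c)) (cong (∣ p ∣ *_) (0≤p⇒∣p∣≡p (basis-≥0 i c)))
    termwise : ∀ c → ∣ x c - y c ∣ ≤ combo (∣ α - α′ ∣) (∣ β - β′ ∣) (∣ γ - γ′ ∣) i j l c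
    termwise c = ≤-trans (≤-reflexive (cong ∣_∣ (trans (cong₂ _-_ (hx c) (hy c))
        (lem α β γ α′ β′ γ′ (basis i c) (basis j c) (basis l c)))))
      (≤-trans (∣p+q∣≤∣p∣+∣q∣ ((α - α′) * basis i c + (β - β′) * basis j c) ((γ - γ′) * basis l c))
        (+-mono-≤ (≤-trans (∣p+q∣≤∣p∣+∣q∣ ((α - α′) * basis i c) ((β - β′) * basis j c))
          (≤-reflexive (cong₂ _+_ (abs-basis (α - α′) i c) (abs-basis (β - β′) j c))))
          (≤-reflexive (abs-basis (γ - γ′) l c))))

module _ (k p : ℕ) where
  open Construction k p
  open Hexagon using (pt; off-axis; corner; next; opposite)

  private
    perimeter : ℚ
    perimeter = ι q + ι q + ι q

    perimeter>0 : 0ℚ < perimeter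
    perimeter>0 = +-mono-< (+-mono-< ιq>0 ιq>0) ιq>0
      where
      ιq>0 : 0ℚ < ι q
      ιq>0 = +-mono-<-≤ (positive⁻¹ 1ℚ) (ι≥0 p)

    instance
      perimeter-pos : Positive perimeter
      perimeter-pos = positive perimeter>0
      perimeter≢0 : NonZero perimeter
      perimeter≢0 = pos⇒nonZero perimeter

  mesh : ℚ
  mesh = 1/ perimeter

  private
    mesh-perimeter : mesh * perimeter ≡ 1ℚ
    mesh-perimeter = *-inverseˡ perimeter

    mesh≥0 : 0ℚ ≤ mesh
    mesh≥0 = <⇒≤ (positive⁻¹ mesh {{1/pos⇒pos perimeter}})

    coord₁ coord₂ coord₃ : ℕ → ℕ → ℚ
    coord₁ a b = mesh * (ι q + ι b)
    coord₂ a b = mesh * (ι q + ι a - ι b)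
    coord₃ a b = mesh * (ι q - ι a)

    coords : Fin k → Fin k → Fin k → ℕ → ℕ → Fin k → ℚ
    coords i j l a b = combo (coord₁ a b) (coord₂ a b) (coord₃ a b) i j l

    coords≥0 : ∀ i j l {a b} → a ℕ.≤ q → b ℕ.≤ q → ∀ c → 0ℚ ≤ coords i j l a b c
    coords≥0 i j l {a} {b} a≤q b≤q = combo≥0
      (*-nonneg mesh≥0 (+-mono-≤ (ι≥0 q) (ι≥0 b)))
      (*-nonneg mesh≥0 (subst (0ℚ ≤_) (lem (ι q) (ι a) (ι b)) (+-mono-≤ (p≤q⇒0≤q-p (ι-mono b≤q)) (ι≥0 a))))
      (*-nonneg mesh≥0 (p≤q⇒0≤q-p (ι-mono a≤q))) i j l
      where
      lem : ∀ q a b → (q - b) + a ≡ q + a - b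
      lem = solve-∀ ℚ-ring

    Σ-coords : ∀ i j l a b → Σℚ k (coords i j l a b) ≡ 1ℚ
    Σ-coords i j l a b = trans (Σ-combo (coord₁ a b) (coord₂ a b) (coord₃ a b) i j l)
      (trans (lem mesh (ι q) (ι a) (ι b)) mesh-perimeter)
      where
      lem : ∀ h q a b → h * (q + b) + h * (q + a - b) + h * (q - a) ≡ h * (q + q + q)
      lem = solve-∀ ℚ-ring

  embedding : Vertex → Fin k → ℚ
  embedding (term i)            = basis i
  embedding (side i j s)        = coords i j j q (toℕ s)
  embedding (center i j l)      = coords i j l 0 0
  embedding (inner i j l r a b) = coords (corner i j l r) (next i j l r) (opposite i j l r) (toℕ a) (toℕ b)

  private
    embedding≥0 : ∀ x c → 0ℚ ≤ embedding x c
    embedding≥0 (term i)            = basis-≥0 i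
    embedding≥0 (side i j s)        = coords≥0 i j j ℕₚ.≤-refl (toℕ≤pred[n] s)
    embedding≥0 (center i j l)      = coords≥0 i j l ℕ.z≤n ℕ.z≤n
    embedding≥0 (inner i j l r a b) = coords≥0 (corner i j l r) (next i j l r) (opposite i j l r) (toℕ≤pred[n] a) (toℕ≤pred[n] b)

    Σ-embedding : ∀ x → Σℚ k (embedding x) ≡ 1ℚ
    Σ-embedding (term i)            = Σ-basis i
    Σ-embedding (side i j s)        = Σ-coords i j j q (toℕ s)
    Σ-embedding (center i j l)      = Σ-coords i j l 0 0
    Σ-embedding (inner i j l r a b) = Σ-coords (corner i j l r) (next i j l r) (opposite i j l r) (toℕ a) (toℕ b)

  fractional : Fin size → Fin k → ℚ
  fractional = embedding ∘ decode

  fractional-feasible : CKRFeasible gapInstance fractional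
  fractional-feasible = embedding≥0 ∘ decode , Σ-embedding ∘ decode , λ i j → cong (λ v → embedding v j) (decode-code (term i))

  private
    coords-cong : ∀ i j l {a a′ b b′} → a ≡ a′ → b ≡ b′ → ∀ c → coords i j l a b c ≡ coords i j l a′ b′ c
    coords-cong i j l refl refl c = refl

    -- On the side a = q the third weight vanishes. Hence `embedding` may repeat j there, and
    -- hexagons with different l agree on the side.
    coords-side : ∀ i j l b c → coords i j j q b c ≡ coords i j l q b c
    coords-side i j l b c = lem mesh (ι q) (ι b) (basis i c) (basis j c) (basis l c)
      where
      lem : ∀ h q b x y z → h * (q + b) * x + h * (q + q - b) * y + h * (q - q) * y
        ≡ h * (q + b) * x + h * (q + q - b) * y + h * (q - q) * z
      lem = solve-∀ ℚ-ring

    coords-axis : ∀ i j l b c → coords i j l b 0 c ≡ coords j l i 0 b c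
    coords-axis i j l b c = lem mesh (ι q) (ι b) (basis i c) (basis j c) (basis l c)
      where
      lem : ∀ h q b x y z → h * (q + 0ℚ) * x + h * (q + b - 0ℚ) * y + h * (q - b) * z
        ≡ h * (q + b) * y + h * (q + 0ℚ - b) * z + h * (q - 0ℚ) * x
      lem = solve-∀ ℚ-ring

    module _ (i j l : Fin k) where

      grid : Fin 3 → ℕ → ℕ → Fin k → ℚ
      grid r = coords (corner i j l r) (next i j l r) (opposite i j l r)

      embedding-off-axis : ∀ {a b} (a≟q : Dec (a ≡ q)) r → a ℕ.≤ q → b ℕ.≤ q → ∀ c →
        embedding (off-axis i j l a≟q r b) c ≡ grid r a b c
      embedding-off-axis {b = b} (yes refl) r a≤q b≤q c = trans
        (coords-cong (corner i j l r) (next i j l r) (next i j l r) {q} refl (toℕ-index b≤q) c)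
        (coords-side (corner i j l r) (next i j l r) (opposite i j l r) b c)
      embedding-off-axis (no _) r a≤q b≤q c =
        coords-cong (corner i j l r) (next i j l r) (opposite i j l r) (toℕ-index a≤q) (toℕ-index b≤q) c

      grid-axis : ∀ r b c → grid (previous r) b 0 c ≡ grid r 0 b c
      grid-axis 0F = coords-axis l i j
      grid-axis 1F = coords-axis i j l
      grid-axis 2F = coords-axis j l i

      embedding-center : ∀ r c → grid 0F 0 0 c ≡ grid r 0 0 c
      embedding-center 0F c = refl
      embedding-center 1F c = grid-axis 1F 0 c
      embedding-center 2F c = trans (grid-axis 1F 0 c) (grid-axis 2F 0 c)

      embedding-pt : ∀ r a b → a ℕ.≤ q → b ℕ.≤ q → ∀ c → embedding (pt i j l r a b) c ≡ grid r a b c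
      embedding-pt r zero    zero    _   _   c = embedding-center r c
      embedding-pt r zero    (suc b) _   b≤q c = trans
        (embedding-off-axis (suc b ℕ.≟ q) (previous r) b≤q ℕ.z≤n c) (grid-axis r (suc b) c)
      embedding-pt r (suc a) b       a≤q b≤q c = embedding-off-axis (suc a ℕ.≟ q) r a≤q b≤q c

  D : Vertex → Vertex → ℚ
  D x y = dist (fractional (code x)) (fractional (code y))

  private
    fractional-code : ∀ x c → fractional (code x) c ≡ embedding x c
    fractional-code x c = cong (λ v → embedding v c) (decode-code x)

    third : mesh * ι q ≡ 1ℚ - mesh * (ι q + ι q)
    third = trans (lem mesh (ι q)) (cong (λ x → x - mesh * (ι q + ι q)) mesh-perimeter)
      where
      lem : ∀ h q → h * q ≡ h * (q + q + q) - h * (q + q)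
      lem = solve-∀ ℚ-ring

    abs-mesh : ∀ x {y} → y ≡ mesh * x → ∣ y ∣ ≡ mesh * ∣ x ∣
    abs-mesh x e = trans (cong ∣_∣ e) (trans (∣p*q∣≡∣p∣*∣q∣ mesh x) (cong (_* ∣ x ∣) (0≤p⇒∣p∣≡p mesh≥0)))

    module _ (i j l : Fin k) (r : Fin 3) where

      -- A grid step (s, t) changes the coordinates by `mesh` times t, s - t and - s. The condition
      -- `norm` holds for the six steps along edges of small triangles.
      near : ∀ {a b a′ b′} → a ℕ.≤ q → b ℕ.≤ q → a′ ℕ.≤ q → b′ ℕ.≤ q → ∀ s t → ι a′ ≡ ι a + s → ι b′ ≡ ι b + t →
        ½ * (∣ - t ∣ + ∣ t - s ∣ + ∣ s ∣) ≡ 1ℚ → D (pt i j l r a b) (pt i j l r a′ b′) ≤ mesh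
      near {a} {b} {a′} {b′} a≤q b≤q a′≤q b′≤q s t ea eb norm = ≤-trans
        (dist-combo {α = coord₁ a b} {coord₂ a b} {coord₃ a b} {coord₁ a′ b′} {coord₂ a′ b′} {coord₃ a′ b′} {corner i j l r} {next i j l r} {opposite i j l r}
          (λ c → trans (fractional-code (pt i j l r a b) c) (embedding-pt i j l r a b a≤q b≤q c))
          (λ c → trans (fractional-code (pt i j l r a′ b′) c) (embedding-pt i j l r a′ b′ a′≤q b′≤q c)))
        (≤-reflexive (trans (cong (½ *_) (cong₂ _+_ (cong₂ _+_
            (abs-mesh (- t) (trans (cong (λ x → mesh * (ι q + ι b) - mesh * (ι q + x)) eb) (lem₁ mesh (ι q) (ι b) t)))
            (abs-mesh (t - s) (trans (cong₂ (λ x y → mesh * (ι q + ι a - ι b) - mesh * (ι q + x - y)) ea eb) (lem₂ mesh (ι q) (ι a) (ι b) s t))))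
            (abs-mesh s (trans (cong (λ x → mesh * (ι q - ι a) - mesh * (ι q - x)) ea) (lem₃ mesh (ι q) (ι a) s)))))
          (trans (factor ½ mesh (∣ - t ∣) (∣ t - s ∣) (∣ s ∣)) (trans (cong (mesh *_) norm) (*-identityʳ mesh)))))
        where
        lem₁ : ∀ h q b t → h * (q + b) - h * (q + (b + t)) ≡ h * (- t)
        lem₁ = solve-∀ ℚ-ring
        lem₂ : ∀ h q a b s t → h * (q + a - b) - h * (q + (a + s) - (b + t)) ≡ h * (t - s)
        lem₂ = solve-∀ ℚ-ring
        lem₃ : ∀ h q a s → h * (q - a) - h * (q - (a + s)) ≡ h * s
        lem₃ = solve-∀ ℚ-ring
        factor : ∀ c h x y z → c * (h * x + h * y + h * z) ≡ h * (c * (x + y + z))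
        factor = solve-∀ ℚ-ring

      -- The distance from a point of the simplex to a vertex is 1 minus the corresponding
      -- coordinate, which is 2/3 on this side; `mesh * ι q` is the remaining 1/3.
      fan-spoke : ∀ {a} → a ℕ.≤ q → D (term (corner i j l r)) (pt i j l r a q) ≤ mesh * ι q
      fan-spoke {a} a≤q = ≤-trans
        (dist-combo {α = 1ℚ} {0ℚ} {0ℚ} {coord₁ a q} {coord₂ a q} {coord₃ a q} {corner i j l r} {next i j l r} {opposite i j l r}
          (λ c → trans (fractional-code (term (corner i j l r)) c) (one (basis (corner i j l r) c) (basis (next i j l r) c) (basis (opposite i j l r) c)))
          (λ c → trans (fractional-code (pt i j l r a q) c) (embedding-pt i j l r a q a≤q ℕₚ.≤-refl c)))
        (≤-reflexive (trans (cong (½ *_) (cong₂ _+_ (cong₂ _+_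
            (abs-mesh (ι q) (sym third))
            (abs-mesh (- ι a) (lem₂ mesh (ι q) (ι a))))
            (abs-mesh (- (ι q - ι a)) (lem₃ mesh (ι q) (ι a)))))
          (trans (cong₂ (λ x y → ½ * (mesh * ∣ ι q ∣ + mesh * x + mesh * y)) (trans (∣-p∣≡∣p∣ (ι a)) (0≤p⇒∣p∣≡p (ι≥0 a)))
              (trans (∣-p∣≡∣p∣ (ι q - ι a)) (0≤p⇒∣p∣≡p (p≤q⇒0≤q-p (ι-mono a≤q)))))
            (trans (cong (λ x → ½ * (mesh * x + mesh * ι a + mesh * (ι q - ι a))) (0≤p⇒∣p∣≡p (ι≥0 q)))
              (trans (half ½ mesh (ι q) (ι a)) (*-identityˡ (mesh * ι q)))))))
        where
        one : ∀ x y z → x ≡ 1ℚ * x + 0ℚ * y + 0ℚ * z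
        one = solve-∀ ℚ-ring
        lem₂ : ∀ h q a → 0ℚ - h * (q + a - q) ≡ h * (- a)
        lem₂ = solve-∀ ℚ-ring
        lem₃ : ∀ h q a → 0ℚ - h * (q - a) ≡ h * (- (q - a))
        lem₃ = solve-∀ ℚ-ring
        half : ∀ c h q a → c * (h * q + h * a + h * (q - a)) ≡ (c + c) * (h * q)
        half = solve-∀ ℚ-ring

      rhombus≤ : rhombusCost D q (term (corner i j l r)) (pt i j l r) ≤
        ι q * (ι q * (mesh + mesh + mesh + (mesh + mesh + mesh)))
        + ι q * (2ℚ * (mesh * ι q) + 2ℚ * (mesh * ι q) + mesh) + ι q * mesh
      rhombus≤ = +-mono-≤ (+-mono-≤
        (≤-trans (Σ-mono q λ s → ≤-trans (Σ-mono q λ t → cell≤ s t)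
            (≤-reflexive (Σ-const q (mesh + mesh + mesh + (mesh + mesh + mesh)))))
          (≤-reflexive (Σ-const q (ι q * (mesh + mesh + mesh + (mesh + mesh + mesh))))))
        (≤-trans (Σ-mono q fan≤) (≤-reflexive (Σ-const q (2ℚ * (mesh * ι q) + 2ℚ * (mesh * ι q) + mesh)))))
        (≤-trans (Σ-mono q side≤) (≤-reflexive (Σ-const q mesh)))
        where
        same : ∀ a → ι a ≡ ι a + 0ℚ
        same a = sym (+-identityʳ (ι a))
        forth : ∀ a → ι (suc a) ≡ ι a + 1ℚ
        forth a = +-comm 1ℚ (ι a)
        back : ∀ a → ι a ≡ ι (suc a) + (- 1ℚ)
        back a = lem (ι a)
          where
          lem : ∀ x → x ≡ 1ℚ + x + (- 1ℚ)
          lem = solve-∀ ℚ-ring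
        P = pt i j l r
        cell≤ : ∀ (s t : Fin q) → let a = toℕ s; b = toℕ t in
          triangle D (P a b) (P a (suc b)) (P (suc a) (suc b)) + triangle D (P a b) (P (suc a) (suc b)) (P (suc a) b)
          ≤ mesh + mesh + mesh + (mesh + mesh + mesh)
        cell≤ s t = +-mono-≤
          (+-mono-≤ (+-mono-≤
            (near a≤ b≤ a≤ b< 0ℚ 1ℚ (same a) (forth b) refl)
            (near a≤ b< a< b< 1ℚ 0ℚ (forth a) (same (suc b)) refl))
            (near a< b< a≤ b≤ (- 1ℚ) (- 1ℚ) (back a) (back b) refl))
          (+-mono-≤ (+-mono-≤
            (near a≤ b≤ a< b< 1ℚ 1ℚ (forth a) (forth b) refl)
            (near a< b< a< b≤ 0ℚ (- 1ℚ) (same (suc a)) (back b) refl))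
            (near a< b≤ a≤ b≤ (- 1ℚ) 0ℚ (back a) (same b) refl))
          where
          a = toℕ s
          b = toℕ t
          a< = toℕ<n s
          b< = toℕ<n t
          a≤ = ℕₚ.<⇒≤ a<
          b≤ = ℕₚ.<⇒≤ b<
        fan≤ : ∀ (s : Fin q) → let a = toℕ s in
          fan D (term (corner i j l r)) (P a q) (P (suc a) q) ≤ 2ℚ * (mesh * ι q) + 2ℚ * (mesh * ι q) + mesh
        fan≤ s = +-mono-≤ (+-mono-≤ (*-monoˡ (nonNegative⁻¹ 2ℚ) (fan-spoke (ℕₚ.<⇒≤ (toℕ<n s))))
            (*-monoˡ (nonNegative⁻¹ 2ℚ) (fan-spoke (toℕ<n s))))
          (near (ℕₚ.<⇒≤ (toℕ<n s)) ℕₚ.≤-refl (toℕ<n s) ℕₚ.≤-refl 1ℚ 0ℚ (forth (toℕ s)) (same q) refl)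
        side≤ : ∀ (t : Fin q) → D (P q (toℕ t)) (P q (suc (toℕ t))) ≤ mesh
        side≤ t = near ℕₚ.≤-refl (ℕₚ.<⇒≤ (toℕ<n t)) ℕₚ.≤-refl (toℕ<n t) 0ℚ 1ℚ (same q) (forth (toℕ t)) refl

    -- With edges of length 1/(3 q), the 6 q² triangles contribute 6 q. The spokes contribute 4 q: 3
    -- q segments, each with two spokes of weight 2 and length 1/3. The second copies of the 6 q
    -- boundary edges give the 2.
    hexagon≤ : ∀ i j l → hexagonCost D i j l ≤ 2ℚ + (2ℚ + 4ℚ + 4ℚ) * ι q
    hexagon≤ i j l = ≤-trans (+-mono-≤ (+-mono-≤ (rhombus≤ i j l 0F) (rhombus≤ i j l 1F)) (rhombus≤ i j l 2F))
      (≤-reflexive (trans (lem mesh (ι q)) (trans (cong (_* (2ℚ + (2ℚ + 4ℚ + 4ℚ) * ι q)) mesh-perimeter) (*-identityˡ _))))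
      where
      lem : ∀ h q → let R = q * (q * (h + h + h + (h + h + h))) + q * (2ℚ * (h * q) + 2ℚ * (h * q) + h) + q * h in
        R + R + R ≡ h * (q + q + q) * (2ℚ + (2ℚ + 4ℚ + 4ℚ) * q)
      lem = solve-∀ ℚ-ring

    module _ (i j : Fin k) where

      height-stop : ∀ {b} → Dec (b ℕ.≤ q) → ℚ
      height-stop {b} (yes _) = mesh * (ι q + ι b)
      height-stop     (no _)  = 1ℚ

      -- The i-th coordinate along the path. The path moves monotonically on an edge of the simplex,
      -- so each step is as long as the rise of this coordinate and the lengths telescope to 1.
      height : ℕ → ℚ
      height zero    = 0ℚ
      height (suc b) = height-stop (b ℕ.≤? q)

      mixture : ℚ → Fin k → ℚ
      mixture φ = combo φ (1ℚ - φ) 0ℚ i j j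

      embedding-stop : ∀ {b} (b≤?q : Dec (b ℕ.≤ q)) c → embedding (stop b≤?q i j) c ≡ mixture (height-stop b≤?q) c
      embedding-stop {b} (yes b≤q) c = trans (coords-cong i j j {q} refl (toℕ-index b≤q) c)
        (trans (lem mesh (ι q) (ι b) (basis i c) (basis j c)) (cong (λ x → mesh * (ι q + ι b) * basis i c + (x - mesh * (ι q + ι b)) * basis j c + 0ℚ * basis j c) mesh-perimeter))
        where
        lem : ∀ h q b x y → h * (q + b) * x + h * (q + q - b) * y + h * (q - q) * y
          ≡ h * (q + b) * x + (h * (q + q + q) - h * (q + b)) * y + 0ℚ * y
        lem = solve-∀ ℚ-ring
      embedding-stop (no _) c = lem (basis i c) (basis j c)
        where
        lem : ∀ x y → x ≡ 1ℚ * x + (1ℚ - 1ℚ) * y + 0ℚ * y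
        lem = solve-∀ ℚ-ring

      embedding-path : ∀ s c → embedding (path i j s) c ≡ mixture (height s) c
      embedding-path zero c = lem (basis i c) (basis j c)
        where
        lem : ∀ x y → y ≡ 0ℚ * x + (1ℚ - 0ℚ) * y + 0ℚ * y
        lem = solve-∀ ℚ-ring
      embedding-path (suc b) c = embedding-stop (b ℕ.≤? q) c

      height-stop-mono : ∀ {b} (d : Dec (b ℕ.≤ q)) (d′ : Dec (suc b ℕ.≤ q)) → height-stop d ≤ height-stop d′
      height-stop-mono {b} (yes _) (yes _) = *-monoˡ mesh≥0 (+-monoʳ-≤ (ι q) (ι-mono (ℕₚ.n≤1+n b)))
      height-stop-mono (yes b≤q) (no _) = ≤-trans (*-monoˡ mesh≥0 (≤-trans (+-monoʳ-≤ (ι q) (ι-mono b≤q))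
        (≤-trans (≤-reflexive (sym (+-identityʳ (ι q + ι q)))) (+-monoʳ-≤ (ι q + ι q) (ι≥0 q))))) (≤-reflexive mesh-perimeter)
      height-stop-mono {b} (no b≰q) (yes b<q) = ⊥-elim (b≰q (ℕₚ.<⇒≤ b<q))
      height-stop-mono (no _) (no _) = ≤-refl

      height-mono : ∀ s → height s ≤ height (suc s)
      height-mono zero    = *-nonneg mesh≥0 (+-mono-≤ (ι≥0 q) ≤-refl)
      height-mono (suc b) = height-stop-mono (b ℕ.≤? q) (suc b ℕ.≤? q)

      height-end : height pathLength ≡ 1ℚ
      height-end with suc q ℕ.≤? q
      ... | yes q<q = ⊥-elim (ℕₚ.<-irrefl refl q<q)
      ... | no _    = refl

      path-step : ∀ s → D (path i j s) (path i j (suc s)) ≤ height (suc s) - height s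
      path-step s = ≤-trans (dist-combo {α = φ} {1ℚ - φ} {0ℚ} {φ′} {1ℚ - φ′} {0ℚ} {i} {j} {j}
          (λ c → trans (fractional-code (path i j s) c) (embedding-path s c))
          (λ c → trans (fractional-code (path i j (suc s)) c) (embedding-path (suc s) c)))
        (≤-reflexive (trans (cong₂ (λ x y → ½ * (x + y + 0ℚ))
            (trans (cong ∣_∣ (flip φ φ′)) (trans (∣-p∣≡∣p∣ (φ′ - φ)) (0≤p⇒∣p∣≡p rises)))
            (trans (cong ∣_∣ (lem φ φ′)) (0≤p⇒∣p∣≡p rises)))
          (trans (half ½ (φ′ - φ)) (*-identityˡ (φ′ - φ)))))
        where
        φ = height s
        φ′ = height (suc s)
        rises : 0ℚ ≤ φ′ - φ
        rises = p≤q⇒0≤q-p (height-mono s)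
        flip : ∀ x y → x - y ≡ - (y - x)
        flip = solve-∀ ℚ-ring
        lem : ∀ x y → 1ℚ - x - (1ℚ - y) ≡ y - x
        lem = solve-∀ ℚ-ring
        half : ∀ c x → c * (x + x + 0ℚ) ≡ (c + c) * x
        half = solve-∀ ℚ-ring

      path≤ : pathCost D i j ≤ 1ℚ
      path≤ = ≤-trans (Σ-mono pathLength λ s → path-step (toℕ s))
        (≤-reflexive (trans (∑-telescope pathLength height) (cong (λ x → x - 0ℚ) height-end)))

  fractional-cost : CKRCost gapInstance fractional ≤
    ι k * (ι k - 1ℚ) * (ι k - 2ℚ) * (2ℚ + (2ℚ + 4ℚ + 4ℚ) * ι q) + ι k * (ι k - 1ℚ) * pathWeight
  fractional-cost = ≤-trans
    (total-≤ (λ s t → dist (fractional s) (fractional t)) {λ _ _ _ → 2ℚ + (2ℚ + 4ℚ + 4ℚ) * ι q} {λ _ _ → 1ℚ}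
      (λ {i} {j} {l} _ → hexagon≤ i j l) (λ {i} {j} _ → path≤ i j))
    (≤-reflexive (cong₂ _+_
      (trans (Σ³-cong k λ i j l → *-comm (χ i j l) H) (trans (Σ³-* k H χ) (trans (cong (H *_) (triples k)) (*-comm H (ι k * (ι k - 1ℚ) * (ι k - 2ℚ))))))
      (trans (Σ²-cong k λ i j → lem (δ i j) pathWeight) (trans (Σ²-* k pathWeight δ) (trans (cong (pathWeight *_) (pairs k)) (*-comm pathWeight (ι k * (ι k - 1ℚ))))))))
    where
    H : ℚ
    H = 2ℚ + (2ℚ + 4ℚ + 4ℚ) * ι q
    lem : ∀ d w → d * (w * 1ℚ) ≡ w * d
    lem = solve-∀ ℚ-ring

  -- A crude bound for the positivity of the optimum: along each path one coordinate rises from 0 to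
  -- 1, and half of that rise bounds the length from below.
  fractional-positive : ∀ x → CKRFeasible gapInstance x → ι k * (ι k - 1ℚ) * (pathWeight * ½) ≤ CKRCost gapInstance x
  fractional-positive x (_ , _ , fixed) = ≤-trans (≤-reflexive (sym sums))
    (total-≥ (λ s t → dist (x s) (x t)) {λ _ _ _ → 0ℚ} {λ _ _ → ½} hexagons≥ paths≥)
    where
    sums : Σ³ k (λ i j l → χ i j l * 0ℚ) + Σ² k (λ i j → δ i j * (pathWeight * ½)) ≡ ι k * (ι k - 1ℚ) * (pathWeight * ½)
    sums = trans (cong₂ _+_
        (trans (Σ³-cong k λ i j l → *-comm (χ i j l) 0ℚ) (trans (Σ³-* k 0ℚ χ) (*-zeroˡ (Σ³ k χ))))
        (trans (Σ²-cong k λ i j → *-comm (δ i j) (pathWeight * ½)) (trans (Σ²-* k (pathWeight * ½) δ)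
          (trans (cong (pathWeight * ½ *_) (pairs k)) (*-comm (pathWeight * ½) (ι k * (ι k - 1ℚ)))))))
      (+-identityˡ (ι k * (ι k - 1ℚ) * (pathWeight * ½)))
    E : Vertex → Vertex → ℚ
    E v v′ = dist (x (code v)) (x (code v′))
    E≥0 : ∀ v v′ → 0ℚ ≤ E v v′
    E≥0 v v′ = dist≥0 (x (code v)) (x (code v′))
    rhombus≥0 : ∀ t P → 0ℚ ≤ rhombusCost E q t P
    rhombus≥0 t P = rhombusCost≥0 {D = E} E≥0 q t P
    hexagons≥ : ∀ {i j l} → Distinct i j l → 0ℚ ≤ hexagonCost E i j l
    hexagons≥ {i} {j} {l} _ = +-mono-≤ (+-mono-≤ (rhombus≥0 (term i) (pt i j l 0F)) (rhombus≥0 (term j) (pt i j l 1F)))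
      (rhombus≥0 (term l) (pt i j l 2F))
    paths≥ : ∀ {i j} → i ≢ j → ½ ≤ pathCost E i j
    paths≥ {i} {j} i≢j = ≤-trans (≤-reflexive (sym (trans
        (trans (Σ-* pathLength ½ (λ s → along (suc (toℕ s)) - along (toℕ s))) (cong (½ *_) (∑-telescope pathLength along)))
        (cong (½ *_) (cong₂ _-_ (trans (cong (λ v → x (code v) i) (path-end i j)) (trans (fixed i i) (basis-refl i)))
          (trans (fixed j i) (basis-≢ (i≢j ∘ sym))))))))
      (Σ-mono pathLength λ s → dist-coordinate (x (code (path i j (toℕ s)))) (x (code (path i j (suc (toℕ s))))) i)
      where
      along : ℕ → ℚ
      along s = x (code (path i j s)) i

-- The gap

toℚᵘ-ι : ∀ n → toℚᵘ (ι n) ≃ᵘ mkℚᵘ (ℤ.+ n) 0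
toℚᵘ-ι zero    = ℚᵘₚ.≃-refl
toℚᵘ-ι (suc n) = ℚᵘₚ.≃-trans (toℚᵘ-homo-+ 1ℚ (ι n)) (ℚᵘₚ.≃-trans (ℚᵘₚ.+-congʳ (toℚᵘ 1ℚ) (toℚᵘ-ι n)) (*≡* (lem (ℤ.+ n))))
  where
  lem : ∀ i → (ℤ.1ℤ ℤ.* ℤ.1ℤ ℤ.+ i ℤ.* ℤ.1ℤ) ℤ.* ℤ.1ℤ ≡ (ℤ.1ℤ ℤ.+ i) ℤ.* (ℤ.1ℤ ℤ.* ℤ.1ℤ)
  lem = ℤ-solver.solve-∀

-- The operation `_/_` reduces its fraction, so the product is evaluated among unnormalised
-- rationals.
/-* : ∀ a b → (ℤ.+ a / suc b) * ι (suc b) ≡ ι a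
/-* a b = toℚᵘ-injective (ℚᵘₚ.≃-trans (toℚᵘ-homo-* (ℤ.+ a / suc b) (ι (suc b)))
  (ℚᵘₚ.≃-trans (ℚᵘₚ.*-cong (toℚᵘ-fromℚᵘ (mkℚᵘ (ℤ.+ a) b)) (toℚᵘ-ι (suc b)))
  (ℚᵘₚ.≃-trans (*≡* (lem (ℤ.+ a) (ℤ.+ suc b))) (ℚᵘₚ.≃-sym (toℚᵘ-ι a)))))
  where
  lem : ∀ i j → (i ℤ.* j) ℤ.* ℤ.1ℤ ≡ i ℤ.* (j ℤ.* ℤ.1ℤ)
  lem = ℤ-solver.solve-∀

ι-+ : ∀ m n → ι (m ℕ.+ n) ≡ ι m + ι n
ι-+ zero    n = sym (+-identityˡ (ι n))
ι-+ (suc m) n = trans (cong (1ℚ +_) (ι-+ m n)) (sym (+-assoc 1ℚ (ι m) (ι n)))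

ι-* : ∀ m n → ι (m ℕ.* n) ≡ ι m * ι n
ι-* zero    n = sym (*-zeroˡ (ι n))
ι-* (suc m) n = trans (ι-+ n (m ℕ.* n)) (trans (cong (ι n +_) (ι-* m n)) (lem (ι m) (ι n)))
  where
  lem : ∀ x y → y + x * y ≡ (1ℚ + x) * y
  lem = solve-∀ ℚ-ring

gapBound-* : ∀ j → gapBound (suc (suc j)) * (1ℚ + ι 5 * (1ℚ + ι j)) ≡ ι 6 * (1ℚ + ι j)
gapBound-* j = trans (cong (λ x → gapBound (suc (suc j)) * (1ℚ + x)) (sym (ι-* 5 (suc j))))
  (trans (/-* (6 ℕ.* suc j) (5 ℕ.* suc j)) (ι-* 6 (suc j)))

archimedean : ∀ ε → 0ℚ < ε → ∃ λ p → 2ℚ ≤ ε * ι (suc p)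
-- For ε = (n + 1)/(d + 1) the grid size `suc p` is 2 (d + 1), so its product with ε is 2 (n + 1).
archimedean ε@(mkℚ (ℤ.+ suc n) d _) 0<ε = d ℕ.+ suc d , ≤-trans
  (+-mono-≤ 1≤ 1≤)
  (≤-reflexive (trans (sym (*-distribˡ-+ ε (ι (suc d)) (ι (suc d)))) (cong (ε *_) (sym (ι-+ (suc d) (suc d))))))
  where
  1≤ : 1ℚ ≤ ε * ι (suc d)
  1≤ = ≤-trans (≤-trans (≤-reflexive (sym (+-identityʳ 1ℚ))) (+-monoʳ-≤ 1ℚ (ι≥0 n)))
    (≤-reflexive (sym (trans (cong (_* ι (suc d)) (sym (↥p/↧p≡p ε))) (/-* (suc n) d))))
archimedean (mkℚ (ℤ.+ zero) d _) 0<ε with () ← positive 0<ε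
archimedean (mkℚ -[1+ n ] d _) 0<ε with () ← positive 0<ε

*-positive : ∀ {p q} → 0ℚ < p → 0ℚ < q → 0ℚ < p * q
*-positive {p} {q} 0<p 0<q = positive⁻¹ (p * q) {{pos*pos⇒pos p {{positive 0<p}} q {{positive 0<q}}}}

-- For c ≤ 0 the left side is at most 0 and the cut cost is nonnegative; so the comparison of `M`
-- and `V` is needed for nonnegative c only.
ratio-bound : ∀ c lp int A M V → 0ℚ ≤ A → 0ℚ ≤ lp → 0ℚ ≤ V → lp ≤ A * M → A * V ≤ int →
  (0ℚ ≤ c → c * M ≤ V) → c * lp ≤ int
ratio-bound c lp int A M V 0≤A 0≤lp 0≤V lp≤ ≤int c*M≤ with ≤-total 0ℚ c
... | inj₁ 0≤c = ≤-trans (*-monoˡ 0≤c lp≤) (≤-trans (≤-reflexive (swap c A M)) (≤-trans (*-monoˡ 0≤A (c*M≤ 0≤c)) ≤int))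
  where
  swap : ∀ a b c → a * (b * c) ≡ b * (a * c)
  swap = solve-∀ ℚ-ring
... | inj₂ c≤0 = ≤-trans (≤-reflexive (*-comm c lp)) (≤-trans (*-monoˡ 0≤lp c≤0)
  (≤-trans (≤-reflexive (*-zeroʳ lp)) (≤-trans (*-nonneg 0≤A 0≤V) ≤int)))

module _ (j p : ℕ) (ε : ℚ) (0<ε : 0ℚ < ε) (2≤εq : 2ℚ ≤ ε * ι (suc p)) where

  private
    k : ℕ
    k = suc (suc j)

  open Construction k p

  K T Q A M W g c : ℚ
  K = ι k
  T = ι j
  Q = ι q
  A = K * (K - 1ℚ)
  W = pathWeight
  M = (K - 2ℚ) * (2ℚ + (2ℚ + 4ℚ + 4ℚ) * Q) + W
  g = gapBound k
  c = g - ε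

  K-1>0 : 0ℚ < K - 1ℚ
  K-1>0 = <-≤-trans (positive⁻¹ 1ℚ) (0≤q-p⇒p≤q (subst (0ℚ ≤_) (lem T) (ι≥0 j)))
    where
    lem : ∀ x → x ≡ (1ℚ + (1ℚ + x)) - 1ℚ - 1ℚ
    lem = solve-∀ ℚ-ring

  A>0 : 0ℚ < A
  A>0 = *-positive (+-mono-<-≤ (positive⁻¹ 1ℚ) (ι≥0 (suc j))) K-1>0

  W>0 : 0ℚ < W
  W>0 = *-positive (*-positive (positive⁻¹ 4ℚ) (+-mono-<-≤ (positive⁻¹ 1ℚ) (ι≥0 p))) (positive⁻¹ (1ℚ + 2ℚ))

  lp>0 : ∀ {lp} → IsCKROpt gapInstance lp → 0ℚ < lp
  lp>0 ((x , feasible , cost≡lp) , _) =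
    <-≤-trans (*-positive A>0 (*-positive W>0 (positive⁻¹ ½)))
      (≤-trans (fractional-positive k p x feasible) (≤-reflexive cost≡lp))

  lp≤ : ∀ {lp} → IsCKROpt gapInstance lp → lp ≤ A * M
  lp≤ (_ , least) = ≤-trans (least (fractional k p) (fractional-feasible k p)) (≤-trans (fractional-cost k p)
    (≤-reflexive (lem A (K - 2ℚ) (2ℚ + (2ℚ + 4ℚ + 4ℚ) * Q) W)))
    where
    lem : ∀ a b c w → a * b * c + a * w ≡ a * (b * c + w)
    lem = solve-∀ ℚ-ring

  ≤int : ∀ {int} → IsIntOpt gapInstance int → W * (A * (K - 1ℚ)) ≤ int
  ≤int ((σ , cut , cost≡int) , _) =
    ≤-trans (cut-bound k p σ cut) (≤-reflexive (trans (sym (CutCost-δ gapInstance σ)) cost≡int))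

  -- Here `M` equals 2 s Q + 2 T and g s = 6 (1 + T), so the terms of order Q in `W * (K - 1ℚ)` and
  -- `g * M` cancel. The discretisation error 2 g T is paid by ε times `M`, which is why ε Q ≥ 2 was
  -- arranged.
  c*M≤ : 0ℚ ≤ c → c * M ≤ W * (K - 1ℚ)
  c*M≤ 0≤c = 0≤q-p⇒p≤q (subst (0ℚ ≤_) (sym identity) slack)
    where
    s e : ℚ
    s = 1ℚ + ι 5 * (1ℚ + T)
    e = ι 6 * (1ℚ + T) - g * s
    0≤ε : 0ℚ ≤ ε
    0≤ε = <⇒≤ 0<ε
    -- From c ≥ 0 follows ε ≤ g, so the fraction `gapBound` need not be examined.
    0≤g : 0ℚ ≤ g
    0≤g = ≤-trans 0≤ε (0≤q-p⇒p≤q 0≤c)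
    e≡0 : e ≡ 0ℚ
    e≡0 = trans (cong (λ x → ι 6 * (1ℚ + T) - x) (gapBound-* j)) (+-inverseʳ (ι 6 * (1ℚ + T)))
    rest : ℚ
    -- What is left after removing `(2ℚ * Q + 2ℚ) * e`. The part 2 Q cancels the leading terms; the
    -- extra 2 trades 2 g s for 12 (1 + T), so that every summand is visibly nonnegative without an
    -- upper bound on g.
    rest = 2ℚ * (ε * T) + 2ℚ * (s * (ε * Q - 2ℚ)) + 2ℚ * (g * (4ℚ * (1ℚ + T) + 2ℚ)) + (4ℚ + 4ℚ) * (1ℚ + T) + 4ℚ
    slack : 0ℚ ≤ rest
    slack = +-mono-≤ (+-mono-≤ (+-mono-≤ (+-mono-≤
      (*-nonneg (nonNegative⁻¹ 2ℚ) (*-nonneg 0≤ε (ι≥0 j)))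
      (*-nonneg (nonNegative⁻¹ 2ℚ) (*-nonneg (+-mono-≤ 0≤1 (*-nonneg (ι≥0 5) (ι≥0 (suc j)))) (p≤q⇒0≤q-p 2≤εq))))
      (*-nonneg (nonNegative⁻¹ 2ℚ) (*-nonneg 0≤g (+-mono-≤ (*-nonneg (nonNegative⁻¹ 4ℚ) (ι≥0 (suc j))) (nonNegative⁻¹ 2ℚ)))))
      (*-nonneg (nonNegative⁻¹ (4ℚ + 4ℚ)) (ι≥0 (suc j)))) (nonNegative⁻¹ 4ℚ)
    lem : ∀ T Q g ε → let K = 1ℚ + (1ℚ + T); s = 1ℚ + ι 5 * (1ℚ + T); W = 4ℚ * Q * (1ℚ + 2ℚ) in
      W * (K - 1ℚ) - (g - ε) * ((K - 2ℚ) * (2ℚ + (2ℚ + 4ℚ + 4ℚ) * Q) + W)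
      ≡ (2ℚ * (ε * T) + 2ℚ * (s * (ε * Q - 2ℚ)) + 2ℚ * (g * (4ℚ * (1ℚ + T) + 2ℚ)) + (4ℚ + 4ℚ) * (1ℚ + T) + 4ℚ)
        + (2ℚ * Q + 2ℚ) * (ι 6 * (1ℚ + T) - g * s)
    lem = solve-∀ ℚ-ring
    identity : W * (K - 1ℚ) - c * M ≡ rest
    identity = trans (lem T Q g ε) (trans (cong (λ x → rest + (2ℚ * Q + 2ℚ) * x) e≡0)
      (trans (cong (λ x → rest + x) (*-zeroʳ (2ℚ * Q + 2ℚ))) (+-identityʳ rest)))

  gap : ∀ {lp int} → IsCKROpt gapInstance lp → IsIntOpt gapInstance int → c * lp ≤ int
  gap {lp} {int} isOpt isInt = ratio-bound c lp int A M (W * (K - 1ℚ)) (<⇒≤ A>0) (<⇒≤ (lp>0 isOpt))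
    (<⇒≤ (*-positive W>0 K-1>0)) (lp≤ isOpt) (≤-trans (≤-reflexive (swap A W (K - 1ℚ))) (≤int isInt)) c*M≤
    where
    swap : ∀ a b c → a * (b * c) ≡ b * (a * c)
    swap = solve-∀ ℚ-ring

  integrality-gap : ∃ (IsCKROpt gapInstance) → ∃ (IsIntOpt gapInstance) → IntegralityGapAtLeast gapInstance c
  integrality-gap (lp , isOpt) (int , isInt) = lp , int , isOpt , isInt , lp>0 isOpt , gap isOpt isInt

theorem1 : (k : ℕ) → k ≥ 3 → (ε : ℚ) → 0ℚ < ε →
    Σ (Instance k) (λ I → IntegralityGapAtLeast I (gapBound k - ε))
theorem1 (suc zero) (ℕ.s≤s ())
theorem1 k@(suc (suc j)) _ ε 0<ε with archimedean ε 0<ε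
... | p , 2≤εq = Construction.gapInstance k p , integrality-gap j p ε 0<ε 2≤εq
  (CKR-attained (Construction.gapInstance k p) (fractional k p) (fractional-feasible k p)) (minimum-cut (Construction.gapInstance k p) (λ _ → zero))
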